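{- Let $A \in \mathbb{F}_2[x]$ be a nonconstant polynomial such that $\omega(A) \leq 3$. Then $A$ is unitary perfect over $\mathbb{F}_2$ if and only if at least one of $A(x)$, $A(x+1)$ is of the form $B^{2^n}$ for some nonnegative integer $n$, where $B$ is one of the following polynomials: (i) $B = x^2+x$; (ii) $B \in \{x^3(x+1)^2(x^2+x+1),\ x^5(x+1)^4(x^4+x^3+x^2+x+1)\}$; (iii) $B = x^3(x+1)^3(x^2+x+1)^2$.
   Context: For a nonzero polynomial $A \in \mathbb{F}_2[x]$, $\omega(A)$ denotes the number of distinct monic irreducible factors of $A$ over $\mathbb{F}_2$. A divisor $d$ of $A$ is called unitary if $d$ is monic and $\gcd(d, A/d) = 1$. $\sigma^*(A)$ denotes the sum of all unitary divisors of $A$. The polynomial $A$ is called unitary perfect if $\sigma^*(A) = A$. -}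

module Defs where

open import Algebra.Bundles using (CommutativeRing; Semiring)
open import Algebra.Structures using (IsCommutativeRing)
import Algebra.Properties.CommutativeSemigroup as CommutativeSemigroupProperties
open import Data.Bool.Base using (Bool; true; false; not; _∧_; _xor_; if_then_else_)
import Data.Bool.Properties as Bool
open import Data.List.Base using (List; []; _∷_; [_]; foldr; filter; length; cartesianProductWith)
open import Data.List.Membership.Propositional using (_∈_)
open import Data.List.Membership.Propositional.Properties
  using (∈-cartesianProductWith⁺; ∈-filter⁺; ∈-filter⁻)
import Data.List.Relation.Unary.All as All
import Data.List.Relation.Unary.Any as Any
open Any using (here; there)
open import Data.List.Relation.Unary.AllPairs using ([]; _∷_)
open import Data.List.Relation.Unary.Unique.Propositional using (Unique)
import Data.List.Relation.Unary.Unique.Propositional.Properties as Unique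
open import Data.Nat.Base as ℕ using (ℕ; zero; suc; _≤_; _<_; z≤n; s≤s)
import Data.Nat.Properties as ℕ
open import Data.Product.Base using (∃-syntax; _×_; _,_; proj₂)
open import Data.Sum.Base using (_⊎_; inj₁; inj₂)
open import Function.Base using (id)
open import Function.Bundles using (_⇔_; mk⇔)
open import Level using (0ℓ)
open import Relation.Binary.Definitions using (DecidableEquality; Decidable)
open import Relation.Binary.PropositionalEquality hiding ([_])
open import Relation.Nullary.Decidable using (Dec; yes; no; map′; ¬?; _×-dec_; _⊎-dec_; _→-dec_)
open import Relation.Nullary.Negation using (¬_; contradiction)
import Relation.Unary as U

-- The field 𝔽₂ is `Bool` with `_xor_` and `_∧_`
-- (`Data.Bool.Properties.xor-∧-commutativeRing`).

infixr 5 _∷_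

-- Since the leading coefficient of a nonzero polynomial over 𝔽₂ is 1,
-- such a polynomial is its list of lower coefficients, constant term
-- first: `one` is 1 and `a ∷ p` is a + x p.
data NonZeroPoly : Set where
  one : NonZeroPoly
  _∷_ : Bool → NonZeroPoly → NonZeroPoly

data 𝔽₂[x] : Set where
  0#  : 𝔽₂[x]
  nz  : NonZeroPoly → 𝔽₂[x]

1# X : 𝔽₂[x]
1# = nz one
X  = nz (false ∷ one)

infixr 5 _∷ₚ_

-- a ∷ₚ p is a + x p, for arbitrary p.
_∷ₚ_ : Bool → 𝔽₂[x] → 𝔽₂[x]
a     ∷ₚ nz p = nz (a ∷ p)
false ∷ₚ 0#   = 0#
true  ∷ₚ 0#   = 1#

infixl 6 _+_
infixl 7 _*_ _·_
infixr 9 _∘_ _∘NZ_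

_⊕_ : NonZeroPoly → NonZeroPoly → 𝔽₂[x]
one     ⊕ one     = 0#
one     ⊕ (b ∷ q) = nz (not b ∷ q)
(a ∷ p) ⊕ one     = nz (not a ∷ p)
(a ∷ p) ⊕ (b ∷ q) = (a xor b) ∷ₚ (p ⊕ q)

_+_ : 𝔽₂[x] → 𝔽₂[x] → 𝔽₂[x]
0#   + q    = q
nz p + 0#   = nz p
nz p + nz q = p ⊕ q

_·_ : Bool → 𝔽₂[x] → 𝔽₂[x]
a · p = if a then p else 0#

_⊗_ : NonZeroPoly → 𝔽₂[x] → 𝔽₂[x]
one     ⊗ q = q
(a ∷ p) ⊗ q = a · q + (false ∷ₚ (p ⊗ q))

_*_ : 𝔽₂[x] → 𝔽₂[x] → 𝔽₂[x]
0#   * q = 0#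
nz p * q = p ⊗ q

-- p ∘ q is the polynomial p(q(x)).
_∘NZ_ : NonZeroPoly → 𝔽₂[x] → 𝔽₂[x]
one     ∘NZ q = 1#
(a ∷ p) ∘NZ q = a · 1# + q * (p ∘NZ q)

_∘_ : 𝔽₂[x] → 𝔽₂[x] → 𝔽₂[x]
0#   ∘ q = 0#
nz p ∘ q = p ∘NZ q

-- The degree of 0 is set to 0.
degNZ : NonZeroPoly → ℕ
degNZ one     = 0
degNZ (_ ∷ p) = suc (degNZ p)

deg : 𝔽₂[x] → ℕ
deg 0#     = 0
deg (nz p) = degNZ p

coeffNZ : NonZeroPoly → ℕ → Bool
coeffNZ one     zero    = true
coeffNZ one     (suc n) = false
coeffNZ (a ∷ p) zero    = a
coeffNZ (a ∷ p) (suc n) = coeffNZ p n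

coeff : 𝔽₂[x] → ℕ → Bool
coeff 0#     n = false
coeff (nz p) n = coeffNZ p n

Monic : 𝔽₂[x] → Set
Monic p = coeff p (deg p) ≡ true

coeffNZ-deg : ∀ p → coeffNZ p (degNZ p) ≡ true
coeffNZ-deg one     = refl
coeffNZ-deg (_ ∷ p) = coeffNZ-deg p

extNZ : ∀ p q → (∀ n → coeffNZ p n ≡ coeffNZ q n) → p ≡ q
extNZ one     one     eq = refl
extNZ one     (b ∷ q) eq with () ← trans (eq (suc (degNZ q))) (coeffNZ-deg q)
extNZ (a ∷ p) one     eq with () ← trans (sym (eq (suc (degNZ p)))) (coeffNZ-deg p)
extNZ (a ∷ p) (b ∷ q) eq = cong₂ _∷_ (eq 0) (extNZ p q (λ n → eq (suc n)))

ext : ∀ p q → (∀ n → coeff p n ≡ coeff q n) → p ≡ q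
ext 0#     0#     eq = refl
ext 0#     (nz q) eq with () ← trans (eq (degNZ q)) (coeffNZ-deg q)
ext (nz p) 0#     eq with () ← trans (sym (eq (degNZ p))) (coeffNZ-deg p)
ext (nz p) (nz q) eq = cong nz (extNZ p q eq)

coeff-∷ₚ-zero : ∀ a p → coeff (a ∷ₚ p) zero ≡ a
coeff-∷ₚ-zero false 0#     = refl
coeff-∷ₚ-zero true  0#     = refl
coeff-∷ₚ-zero a     (nz p) = refl

coeff-∷ₚ-suc : ∀ a p n → coeff (a ∷ₚ p) (suc n) ≡ coeff p n
coeff-∷ₚ-suc false 0#     n = refl
coeff-∷ₚ-suc true  0#     n = refl
coeff-∷ₚ-suc a     (nz p) n = refl

coeff-⊕ : ∀ p q n → coeff (p ⊕ q) n ≡ coeffNZ p n xor coeffNZ q n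
coeff-⊕ one     one     zero    = refl
coeff-⊕ one     one     (suc n) = refl
coeff-⊕ one     (b ∷ q) zero    = refl
coeff-⊕ one     (b ∷ q) (suc n) = refl
coeff-⊕ (a ∷ p) one     zero    = sym (Bool.xor-comm a true)
coeff-⊕ (a ∷ p) one     (suc n) = sym (Bool.xor-identityʳ _)
coeff-⊕ (a ∷ p) (b ∷ q) zero    = coeff-∷ₚ-zero (a xor b) (p ⊕ q)
coeff-⊕ (a ∷ p) (b ∷ q) (suc n) =
  trans (coeff-∷ₚ-suc (a xor b) (p ⊕ q) n) (coeff-⊕ p q n)

coeff-+ : ∀ p q n → coeff (p + q) n ≡ coeff p n xor coeff q n
coeff-+ 0#     q      n = refl
coeff-+ (nz p) 0#     n = sym (Bool.xor-identityʳ _)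
coeff-+ (nz p) (nz q) n = coeff-⊕ p q n

+-comm : ∀ p q → p + q ≡ q + p
+-comm p q = ext _ _ λ n → begin
  coeff (p + q) n          ≡⟨ coeff-+ p q n ⟩
  coeff p n xor coeff q n  ≡⟨ Bool.xor-comm (coeff p n) _ ⟩
  coeff q n xor coeff p n  ≡⟨ coeff-+ q p n ⟨
  coeff (q + p) n          ∎
  where open ≡-Reasoning

+-assoc : ∀ p q r → (p + q) + r ≡ p + (q + r)
+-assoc p q r = ext _ _ λ n → begin
  coeff ((p + q) + r) n                      ≡⟨ coeff-+ (p + q) r n ⟩
  coeff (p + q) n xor coeff r n              ≡⟨ cong (_xor coeff r n) (coeff-+ p q n) ⟩
  (coeff p n xor coeff q n) xor coeff r n    ≡⟨ Bool.xor-assoc (coeff p n) _ _ ⟩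
  coeff p n xor (coeff q n xor coeff r n)    ≡⟨ cong (coeff p n xor_) (coeff-+ q r n) ⟨
  coeff p n xor coeff (q + r) n              ≡⟨ coeff-+ p (q + r) n ⟨
  coeff (p + (q + r)) n                      ∎
  where open ≡-Reasoning

+-identityʳ : ∀ p → p + 0# ≡ p
+-identityʳ p = +-comm p 0#

p+p≡0 : ∀ p → p + p ≡ 0#
p+p≡0 p = ext _ _ λ n → trans (coeff-+ p p n) (Bool.xor-same (coeff p n))

+-interchange : ∀ p q r s → (p + q) + (r + s) ≡ (p + r) + (q + s)
+-interchange = CommutativeSemigroupProperties.interchange record
  { isCommutativeSemigroup = record
    { isSemigroup = record
      { isMagma = record { isEquivalence = isEquivalence ; ∙-cong = cong₂ _+_ }
      ; assoc   = +-assoc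
      }
    ; comm = +-comm
    }
  }

∷ₚ-injective : ∀ {a b p q} → a ∷ₚ p ≡ b ∷ₚ q → a ≡ b × p ≡ q
∷ₚ-injective {a} {b} {p} {q} eq =
    trans (sym (coeff-∷ₚ-zero a p)) (trans (cong (λ r → coeff r 0) eq) (coeff-∷ₚ-zero b q))
  , ext p q λ n → trans (sym (coeff-∷ₚ-suc a p n))
                    (trans (cong (λ r → coeff r (suc n)) eq) (coeff-∷ₚ-suc b q n))

𝔽₂[x]-ind : ∀ {ℓ} (P : 𝔽₂[x] → Set ℓ) → P 0# → (∀ a p → P p → P (a ∷ₚ p)) → ∀ p → P p
𝔽₂[x]-ind P base step 0#           = base
𝔽₂[x]-ind P base step (nz one)     = step true 0# base
𝔽₂[x]-ind P base step (nz (a ∷ p)) = step a (nz p) (𝔽₂[x]-ind P base step (nz p))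

∷ₚ-+ : ∀ a b p q → (a ∷ₚ p) + (b ∷ₚ q) ≡ (a xor b) ∷ₚ (p + q)
∷ₚ-+ a b p q = ext _ _ eq
  where
  open ≡-Reasoning
  eq : ∀ n → coeff ((a ∷ₚ p) + (b ∷ₚ q)) n ≡ coeff ((a xor b) ∷ₚ (p + q)) n
  eq zero = begin
    coeff ((a ∷ₚ p) + (b ∷ₚ q)) 0            ≡⟨ coeff-+ (a ∷ₚ p) (b ∷ₚ q) 0 ⟩
    coeff (a ∷ₚ p) 0 xor coeff (b ∷ₚ q) 0    ≡⟨ cong₂ _xor_ (coeff-∷ₚ-zero a p) (coeff-∷ₚ-zero b q) ⟩
    a xor b                                  ≡⟨ coeff-∷ₚ-zero (a xor b) (p + q) ⟨
    coeff ((a xor b) ∷ₚ (p + q)) 0           ∎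
  eq (suc n) = begin
    coeff ((a ∷ₚ p) + (b ∷ₚ q)) (suc n)                  ≡⟨ coeff-+ (a ∷ₚ p) (b ∷ₚ q) (suc n) ⟩
    coeff (a ∷ₚ p) (suc n) xor coeff (b ∷ₚ q) (suc n)    ≡⟨ cong₂ _xor_ (coeff-∷ₚ-suc a p n) (coeff-∷ₚ-suc b q n) ⟩
    coeff p n xor coeff q n                              ≡⟨ coeff-+ p q n ⟨
    coeff (p + q) n                                      ≡⟨ coeff-∷ₚ-suc (a xor b) (p + q) n ⟨
    coeff ((a xor b) ∷ₚ (p + q)) (suc n)                 ∎

∷ₚ-* : ∀ a p q → (a ∷ₚ p) * q ≡ a · q + (false ∷ₚ p * q)
∷ₚ-* false 0#     q = refl
∷ₚ-* true  0#     q = sym (+-identityʳ q)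
∷ₚ-* false (nz p) q = refl
∷ₚ-* true  (nz p) q = refl

·-∷ₚ : ∀ a b p → a · (b ∷ₚ p) ≡ (a ∧ b) ∷ₚ a · p
·-∷ₚ false b p = refl
·-∷ₚ true  b p = refl

·-distribˡ : ∀ a p q → a · (p + q) ≡ a · p + a · q
·-distribˡ false p q = refl
·-distribˡ true  p q = refl

·-distribʳ : ∀ a b p → (a xor b) · p ≡ a · p + b · p
·-distribʳ false b     p = refl
·-distribʳ true  false p = sym (+-identityʳ p)
·-distribʳ true  true  p = sym (p+p≡0 p)

·-*-assoc : ∀ a p q → (a · p) * q ≡ a · (p * q)
·-*-assoc false p q = refl
·-*-assoc true  p q = refl

*-zeroʳ : ∀ p → p * 0# ≡ 0#
*-zeroʳ = 𝔽₂[x]-ind _ refl λ a p ih → begin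
  (a ∷ₚ p) * 0#                ≡⟨ ∷ₚ-* a p 0# ⟩
  a · 0# + (false ∷ₚ p * 0#)   ≡⟨ cong₂ (λ u v → u + (false ∷ₚ v)) (Bool.if-eta a) ih ⟩
  0#                           ∎
  where open ≡-Reasoning

*-distribʳ-+ : ∀ r p q → (p + q) * r ≡ p * r + q * r
*-distribʳ-+ r p q = 𝔽₂[x]-ind (λ p → ∀ q → (p + q) * r ≡ p * r + q * r) (λ _ → refl)
  (λ a p ih → 𝔽₂[x]-ind _
    (trans (cong (_* r) (+-identityʳ (a ∷ₚ p))) (sym (+-identityʳ _)))
    (λ b q _ → begin
      ((a ∷ₚ p) + (b ∷ₚ q)) * r
        ≡⟨ cong (_* r) (∷ₚ-+ a b p q) ⟩
      ((a xor b) ∷ₚ (p + q)) * r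
        ≡⟨ ∷ₚ-* (a xor b) (p + q) r ⟩
      (a xor b) · r + (false ∷ₚ (p + q) * r)
        ≡⟨ cong₂ (λ u v → u + (false ∷ₚ v)) (·-distribʳ a b r) (ih q) ⟩
      (a · r + b · r) + (false ∷ₚ (p * r + q * r))
        ≡⟨ cong ((a · r + b · r) +_) (∷ₚ-+ false false (p * r) (q * r)) ⟨
      (a · r + b · r) + ((false ∷ₚ p * r) + (false ∷ₚ q * r))
        ≡⟨ +-interchange (a · r) _ _ _ ⟩
      (a · r + (false ∷ₚ p * r)) + (b · r + (false ∷ₚ q * r))
        ≡⟨ cong₂ _+_ (∷ₚ-* a p r) (∷ₚ-* b q r) ⟨
      (a ∷ₚ p) * r + (b ∷ₚ q) * r ∎))
  p q
  where open ≡-Reasoning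

*-∷ₚ : ∀ q a p → q * (a ∷ₚ p) ≡ a · q + (false ∷ₚ q * p)
*-∷ₚ q a p = 𝔽₂[x]-ind (λ q → q * (a ∷ₚ p) ≡ a · q + (false ∷ₚ q * p))
  (cong (_+ 0#) (sym (Bool.if-eta a)))
  (λ b q ih → begin
    (b ∷ₚ q) * (a ∷ₚ p)
      ≡⟨ ∷ₚ-* b q (a ∷ₚ p) ⟩
    b · (a ∷ₚ p) + (false ∷ₚ q * (a ∷ₚ p))
      ≡⟨ cong₂ (λ u v → u + (false ∷ₚ v)) (·-∷ₚ b a p) ih ⟩
    ((b ∧ a) ∷ₚ b · p) + (false ∷ₚ (a · q + (false ∷ₚ q * p)))
      ≡⟨ ∷ₚ-+ (b ∧ a) false (b · p) _ ⟩
    ((b ∧ a) xor false) ∷ₚ (b · p + (a · q + (false ∷ₚ q * p)))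
      ≡⟨ cong₂ (λ c → (c xor false) ∷ₚ_) (Bool.∧-comm b a)
           (trans (sym (+-assoc (b · p) _ _))
             (trans (cong (_+ _) (+-comm (b · p) (a · q))) (+-assoc (a · q) _ _))) ⟩
    ((a ∧ b) xor false) ∷ₚ (a · q + (b · p + (false ∷ₚ q * p)))
      ≡⟨ ∷ₚ-+ (a ∧ b) false (a · q) _ ⟨
    ((a ∧ b) ∷ₚ a · q) + (false ∷ₚ (b · p + (false ∷ₚ q * p)))
      ≡⟨ cong₂ (λ u v → u + (false ∷ₚ v)) (·-∷ₚ a b q) (∷ₚ-* b q p) ⟨
    a · (b ∷ₚ q) + (false ∷ₚ (b ∷ₚ q) * p) ∎)
  q
  where open ≡-Reasoning

*-comm : ∀ p q → p * q ≡ q * p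
*-comm p q = 𝔽₂[x]-ind (λ p → p * q ≡ q * p) (sym (*-zeroʳ q))
  (λ a p ih → begin
    (a ∷ₚ p) * q               ≡⟨ ∷ₚ-* a p q ⟩
    a · q + (false ∷ₚ p * q)   ≡⟨ cong (λ u → a · q + (false ∷ₚ u)) ih ⟩
    a · q + (false ∷ₚ q * p)   ≡⟨ *-∷ₚ q a p ⟨
    q * (a ∷ₚ p)               ∎)
  p
  where open ≡-Reasoning

*-assoc : ∀ p q r → (p * q) * r ≡ p * (q * r)
*-assoc p q r = 𝔽₂[x]-ind (λ p → (p * q) * r ≡ p * (q * r)) refl
  (λ a p ih → begin
    ((a ∷ₚ p) * q) * r
      ≡⟨ cong (_* r) (∷ₚ-* a p q) ⟩
    (a · q + (false ∷ₚ p * q)) * r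
      ≡⟨ *-distribʳ-+ r (a · q) _ ⟩
    (a · q) * r + (false ∷ₚ p * q) * r
      ≡⟨ cong₂ _+_ (·-*-assoc a q r) (∷ₚ-* false (p * q) r) ⟩
    a · (q * r) + (false ∷ₚ (p * q) * r)
      ≡⟨ cong (λ u → a · (q * r) + (false ∷ₚ u)) ih ⟩
    a · (q * r) + (false ∷ₚ p * (q * r))
      ≡⟨ ∷ₚ-* a p (q * r) ⟨
    (a ∷ₚ p) * (q * r) ∎)
  p
  where open ≡-Reasoning

*-distribˡ-+ : ∀ p q r → p * (q + r) ≡ p * q + p * r
*-distribˡ-+ p q r = trans (*-comm p (q + r))
  (trans (*-distribʳ-+ p q r) (cong₂ _+_ (*-comm q p) (*-comm r p)))

+-*-isCommutativeRing : IsCommutativeRing _≡_ _+_ _*_ id 0# 1#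
+-*-isCommutativeRing = record
  { isRing = record
    { +-isAbelianGroup = record
      { isGroup = record
        { isMonoid = record
          { isSemigroup = record
            { isMagma = record { isEquivalence = isEquivalence ; ∙-cong = cong₂ _+_ }
            ; assoc   = +-assoc
            }
          ; identity = (λ _ → refl) , +-identityʳ
          }
        ; inverse = p+p≡0 , p+p≡0
        ; ⁻¹-cong = id
        }
      ; comm = +-comm
      }
    ; *-cong     = cong₂ _*_
    ; *-assoc    = *-assoc
    ; *-identity = (λ _ → refl) , (λ p → *-comm p 1#)
    ; distrib    = *-distribˡ-+ , *-distribʳ-+
    }
  ; *-comm = *-comm
  }

+-*-commutativeRing : CommutativeRing 0ℓ 0ℓ
+-*-commutativeRing = record { isCommutativeRing = +-*-isCommutativeRing }

open import Algebra.Definitions.RawSemiring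
  (Semiring.rawSemiring (CommutativeRing.semiring +-*-commutativeRing)) public
  using (_∣_; _∤_; _^_; Coprime; Irreducible; mkIrred)
open import Algebra.Definitions.RawMagma
  (Semiring.*-rawMagma (CommutativeRing.semiring +-*-commutativeRing))
  using (_,_)

_≟NZ_ : DecidableEquality NonZeroPoly
one     ≟NZ one     = yes refl
one     ≟NZ (_ ∷ _) = no λ ()
(_ ∷ _) ≟NZ one     = no λ ()
(a ∷ p) ≟NZ (b ∷ q) = map′ (λ (a≡b , p≡q) → cong₂ _∷_ a≡b p≡q) (λ { refl → refl , refl })
                        ((a Bool.≟ b) ×-dec (p ≟NZ q))

infix 4 _≟_
_≟_ : DecidableEquality 𝔽₂[x]
0#   ≟ 0#   = yes refl
0#   ≟ nz _ = no λ ()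
nz _ ≟ 0#   = no λ ()
nz p ≟ nz q = map′ (cong nz) (λ { refl → refl }) (p ≟NZ q)

-- All polynomials of degree < n, including 0.
deg< : ℕ → List 𝔽₂[x]
deg< zero    = [ 0# ]
deg< (suc n) = cartesianProductWith _∷ₚ_ (false ∷ true ∷ []) (deg< n)

∈-deg<-∷ₚ : ∀ n a {p} → p ∈ deg< n → a ∷ₚ p ∈ deg< (suc n)
∈-deg<-∷ₚ n a p∈ = ∈-cartesianProductWith⁺ _∷ₚ_ (a∈ a) p∈
  where
  a∈ : ∀ a → a ∈ false ∷ true ∷ []
  a∈ false = here refl
  a∈ true  = there (here refl)

0∈deg< : ∀ n → 0# ∈ deg< n
0∈deg< zero    = here refl
0∈deg< (suc n) = ∈-deg<-∷ₚ n false (0∈deg< n)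

∈-deg< : ∀ n p → deg p < n → p ∈ deg< n
∈-deg< n       0#           _         = 0∈deg< n
∈-deg< (suc n) (nz one)     (s≤s _)   = ∈-deg<-∷ₚ n true (0∈deg< n)
∈-deg< (suc n) (nz (a ∷ p)) (s≤s p<n) = ∈-deg<-∷ₚ n a (∈-deg< n (nz p) p<n)

deg<-unique : ∀ n → Unique (deg< n)
deg<-unique zero    = All.[] ∷ []
deg<-unique (suc n) = Unique.cartesianProductWith⁺ _∷ₚ_ ∷ₚ-injective
  (((λ ()) All.∷ All.[]) ∷ All.[] ∷ []) (deg<-unique n)

module _ {ℓ} {P : 𝔽₂[x] → Set ℓ} (P? : U.Decidable P) (n : ℕ) where

  ∃deg? : (∀ {p} → P p → deg p < n) → Dec (∃[ p ] P p)
  ∃deg? bound = map′ Any.satisfied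
    (λ (p , Pp) → Any.map (λ { refl → Pp }) (∈-deg< n p (bound Pp)))
    (Any.any? P? (deg< n))

  ∀deg? : (∀ p → n ≤ deg p → P p) → Dec (∀ p → P p)
  ∀deg? bound = map′ to (λ f → All.tabulate (λ {p} _ → f p)) (All.all? P? (deg< n))
    where
    to : All.All P (deg< n) → ∀ p → P p
    to all p with deg p ℕ.<? n
    ... | yes p<n = All.lookup all (∈-deg< n p p<n)
    ... | no  p≮n = bound p (ℕ.≮⇒≥ p≮n)

coeff-deg< : ∀ p {n} → deg p < n → coeff p n ≡ false
coeff-deg< 0#           _         = refl
coeff-deg< (nz one)     (s≤s _)   = refl
coeff-deg< (nz (a ∷ p)) (s≤s p<n) = coeff-deg< (nz p) p<n

coeff-deg≤ : ∀ p {n} → coeff p n ≡ true → n ≤ deg p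
coeff-deg≤ p {n} eq = ℕ.≮⇒≥ λ p<n → contradiction (trans (sym eq) (coeff-deg< p p<n)) λ ()

coeff-⊗ : ∀ p q → coeff (p ⊗ nz q) (degNZ p ℕ.+ degNZ q) ≡ true
coeff-⊗ one     q = coeffNZ-deg q
coeff-⊗ (a ∷ p) q = begin
  coeff (a · nz q + (false ∷ₚ p ⊗ nz q)) (suc n)
    ≡⟨ coeff-+ (a · nz q) _ (suc n) ⟩
  coeff (a · nz q) (suc n) xor coeff (false ∷ₚ p ⊗ nz q) (suc n)
    ≡⟨ cong₂ _xor_ (low a) (coeff-∷ₚ-suc false (p ⊗ nz q) n) ⟩
  coeff (p ⊗ nz q) n
    ≡⟨ coeff-⊗ p q ⟩
  true ∎
  where
  open ≡-Reasoning
  n = degNZ p ℕ.+ degNZ q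
  low : ∀ a → coeff (a · nz q) (suc n) ≡ false
  low false = refl
  low true  = coeff-deg< (nz q) (s≤s (ℕ.m≤n+m _ _))

deg-* : ∀ p q → degNZ p ℕ.+ degNZ q ≤ deg (nz p * nz q)
deg-* p q = coeff-deg≤ (nz p * nz q) (coeff-⊗ p q)

nz*nz≢0 : ∀ p q → nz p * nz q ≢ 0#
nz*nz≢0 p q eq with () ← trans (sym (coeff-⊗ p q)) (cong (λ r → coeff r (degNZ p ℕ.+ degNZ q)) eq)

cofactor< : ∀ p q {r} → q * nz p ≡ r → deg q < suc (deg r)
cofactor< p 0#     eq   = s≤s z≤n
cofactor< p (nz q) refl = s≤s (ℕ.≤-trans (ℕ.m≤m+n _ _) (deg-* q p))

infix 4 _∣?_
_∣?_ : Decidable _∣_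
0#   ∣? r = map′ (λ 0≡r → 0# , 0≡r) (λ (q , q0≡r) → trans (sym (*-zeroʳ q)) q0≡r) (0# ≟ r)
nz p ∣? r = map′ (λ (q , eq) → q , eq) (λ (q , eq) → q , eq)
  (∃deg? (λ q → q * nz p ≟ r) (suc (deg r)) (λ {q} → cofactor< p q))

∣nz⇒deg≤ : ∀ {p q} → p ∣ nz q → deg p ≤ degNZ q
∣nz⇒deg≤ {0#}   _           = z≤n
∣nz⇒deg≤ {nz p} (0# , ())
∣nz⇒deg≤ {nz p} (nz r , eq) =
  ℕ.≤-trans (ℕ.m≤n+m _ _) (ℕ.≤-trans (deg-* r p) (ℕ.≤-reflexive (cong deg eq)))

coprime? : ∀ p q → Dec (Coprime (nz p) q)
coprime? p q = map′ (λ f {r} → f r) (λ f r → f {r})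
  (∀deg? (λ r → (r ∣? nz p) →-dec ((r ∣? q) →-dec (r ∣? 1#))) (suc (degNZ p))
    (λ r p<r r∣p → contradiction (∣nz⇒deg≤ r∣p) (ℕ.<⇒≱ p<r)))

0∤1 : 0# ∤ 1#
0∤1 (q , eq) with () ← trans (sym (*-zeroʳ q)) eq

irreducible? : U.Decidable Irreducible
irreducible? 0# = no λ irr → case (Irreducible.split-∣1 irr {0#} {0#} refl)
  where
  case : ¬ (0# ∣ 1# ⊎ 0# ∣ 1#)
  case (inj₁ 0∣1) = 0∤1 0∣1
  case (inj₂ 0∣1) = 0∤1 0∣1
irreducible? (nz p) = map′
  (λ (p∤1 , split) → mkIrred p∤1 (λ {x} {y} → split x y))
  (λ irr → Irreducible.p∤1 irr , λ x y → Irreducible.split-∣1 irr)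
  (¬? (nz p ∣? 1#) ×-dec
   ∀deg? (λ x → ∀deg? (λ y → (nz p ≟ x * y) →-dec ((x ∣? 1#) ⊎-dec (y ∣? 1#))) n
       (λ y p<y eq → contradiction (∣nz⇒deg≤ {y} (x , sym eq)) (ℕ.<⇒≱ p<y)))
     n
     (λ x p<x y eq →
       contradiction (∣nz⇒deg≤ {x} (y , trans (*-comm y x) (sym eq))) (ℕ.<⇒≱ p<x)))
  where n = suc (degNZ p)

MonicIrreducibleFactor : 𝔽₂[x] → 𝔽₂[x] → Set
MonicIrreducibleFactor A p = Monic p × Irreducible p × p ∣ A

monicIrreducibleFactor? : ∀ A → U.Decidable (MonicIrreducibleFactor A)
monicIrreducibleFactor? A p =
  (coeff p (deg p) Bool.≟ true) ×-dec (irreducible? p ×-dec (p ∣? A))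

-- Divisors of a nonzero A have degree at most deg A.  The values of
-- this list, of `unitaryDivisors` and of the functions `ω` and `σ*` at
-- A = 0 carry no meaning.
monicIrreducibleFactors : 𝔽₂[x] → List 𝔽₂[x]
monicIrreducibleFactors A = filter (monicIrreducibleFactor? A) (deg< (suc (deg A)))

ω : 𝔽₂[x] → ℕ
ω A = length (monicIrreducibleFactors A)

-- The witness q is A/d.
UnitaryDivisor : 𝔽₂[x] → 𝔽₂[x] → Set
UnitaryDivisor A d = Monic d × ∃[ q ] q * d ≡ A × Coprime d q

unitaryDivisor? : ∀ A → U.Decidable (UnitaryDivisor A)
unitaryDivisor? A 0#     = no λ ()
unitaryDivisor? A (nz d) = (coeffNZ d (degNZ d) Bool.≟ true) ×-dec
  ∃deg? (λ q → (q * nz d ≟ A) ×-dec coprime? d q) (suc (deg A)) (λ {q} (eq , _) → cofactor< d q eq)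

unitaryDivisors : 𝔽₂[x] → List 𝔽₂[x]
unitaryDivisors A = filter (unitaryDivisor? A) (deg< (suc (deg A)))

σ* : 𝔽₂[x] → 𝔽₂[x]
σ* A = foldr _+_ 0# (unitaryDivisors A)

UnitaryPerfect : 𝔽₂[x] → Set
UnitaryPerfect A = σ* A ≡ A

∈-monicIrreducibleFactors : ∀ {A p} → A ≢ 0# →
  p ∈ monicIrreducibleFactors A ⇔ MonicIrreducibleFactor A p
∈-monicIrreducibleFactors {0#}   A≢0 = contradiction refl A≢0
∈-monicIrreducibleFactors {nz A} _   = mk⇔
  (λ p∈ → proj₂ (∈-filter⁻ (monicIrreducibleFactor? (nz A)) {xs = deg< (suc (degNZ A))} p∈))
  (λ (m , i , p∣A) → ∈-filter⁺ (monicIrreducibleFactor? (nz A))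
    (∈-deg< (suc (degNZ A)) _ (s≤s (∣nz⇒deg≤ p∣A))) (m , i , p∣A))

monicIrreducibleFactors-unique : ∀ A → Unique (monicIrreducibleFactors A)
monicIrreducibleFactors-unique A = Unique.filter⁺ (monicIrreducibleFactor? A) (deg<-unique (suc (deg A)))

∈-unitaryDivisors : ∀ {A d} → A ≢ 0# → d ∈ unitaryDivisors A ⇔ UnitaryDivisor A d
∈-unitaryDivisors {0#}   A≢0 = contradiction refl A≢0
∈-unitaryDivisors {nz A} _   = mk⇔
  (λ d∈ → proj₂ (∈-filter⁻ (unitaryDivisor? (nz A)) {xs = deg< (suc (degNZ A))} d∈))
  (λ (m , q , eq , c) → ∈-filter⁺ (unitaryDivisor? (nz A))
    (∈-deg< (suc (degNZ A)) _ (s≤s (∣nz⇒deg≤ (q , eq)))) (m , q , eq , c))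

unitaryDivisors-unique : ∀ A → Unique (unitaryDivisors A)
unitaryDivisors-unique A = Unique.filter⁺ (unitaryDivisor? A) (deg<-unique (suc (deg A)))

data Listed : 𝔽₂[x] → Set where
  case-i    : Listed (X ^ 2 + X)
  case-ii₁  : Listed (X ^ 3 * (X + 1#) ^ 2 * (X ^ 2 + X + 1#))
  case-ii₂  : Listed (X ^ 5 * (X + 1#) ^ 4 * (X ^ 4 + X ^ 3 + X ^ 2 + X + 1#))
  case-iii  : Listed (X ^ 3 * (X + 1#) ^ 3 * (X ^ 2 + X + 1#) ^ 2)

ListedPower : 𝔽₂[x] → Set
ListedPower A = ∃[ B ] ∃[ n ] Listed B × A ≡ B ^ (2 ℕ.^ n)

module Submission where

-- σ* is multiplicative, with σ*(P^a) = 1 + P^a for P irreducible.  If X or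
-- X + 1 did not divide a unitary perfect A, it would divide 1 + P^a = σ*(P^a)
-- for any prime power P^a exactly dividing A, hence A itself.  So
-- A = X^a (X + 1)^b P^c, where P may be missing, and the condition reads
-- (1 + X^a) (1 + (X + 1)^b) (1 + P^c) = X^a (X + 1)^b P^c.  If u is the odd part
-- of a, then 1 + X^u is squarefree (its derivative is a power of X) and prime
-- to X, so it is X + 1 or (X + 1) P; likewise for b.  The odd part of c is 1 and
-- 1 + P = X^e (X + 1)^f.  From 1 + X^u = (X + 1) P with u > 1 one gets
-- u = 2^s + 1 and 1 + P = X (X + 1)^(2^s - 1).  Comparing exponents leaves, up
-- to exchanging X and X + 1, case (iii) and the family
-- (X^(q+1) (X + 1)^q P)^(2^n) with q = 2^s.  In the latter,
-- P is irreducible only for s ≤ 2: the sum R of X^(2^i), i < 2 s, reduced modulo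
-- X^(q+1) + 1, has degree at most q and satisfies R² = R there, so that P would
-- divide R or R + 1; this fails modulo X⁴ as soon as s ≥ 3.

open import Defs
open import Algebra.Bundles using (CommutativeRing; Semiring)
open import Algebra.Definitions.RawMagma
  (Semiring.*-rawMagma (CommutativeRing.semiring +-*-commutativeRing)) using (_,_)
open import Algebra.Properties.CommutativeSemiring.Exp
  (CommutativeRing.commutativeSemiring +-*-commutativeRing) using (^-distrib-*)
open import Algebra.Properties.Semiring.Exp
  (CommutativeRing.semiring +-*-commutativeRing) using (^-homo-*; ^-assocʳ)
import Algebra.Solver.Ring
open import Algebra.Solver.Ring.AlmostCommutativeRing
  using (fromCommutativeRing; _-Raw-AlmostCommutative⟶_)
open import Data.Bool.Base using (true; false; _∧_; _xor_)
import Data.Bool.Properties as Bool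
open import Data.Empty using (⊥)
open import Data.List.Base using (List; []; _∷_; _++_; map; foldr; length)
open import Data.List.Membership.Propositional using (_∈_)
open import Data.List.Membership.Propositional.Properties
  using (∈-∃++; ∈-++⁺ˡ; ∈-++⁺ʳ; ∈-++⁻; ∈-map⁺; ∈-map⁻)
open import Data.List.Membership.Propositional.Properties.WithK using (unique∧set⇒bag)
open import Data.List.Properties using (length-++-sucʳ)
open import Data.List.Relation.Binary.BagAndSetEquality using (∼bag⇒↭)
open import Data.List.Relation.Binary.Permutation.Propositional using (_↭_; ↭⇒↭ₛ)
open import Data.List.Relation.Binary.Permutation.Setoid.Properties using (foldr-commMonoid)
import Data.List.Relation.Unary.All as All
open import Data.List.Relation.Unary.AllPairs using ([]; _∷_)
open import Data.List.Relation.Unary.Any using (here; there)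
open import Data.List.Relation.Unary.Unique.Propositional using (Unique)
import Data.List.Relation.Unary.Unique.Propositional.Properties as Unique
open import Data.Maybe.Base using (Maybe; just; nothing)
open import Data.Nat.Base as ℕ using (ℕ; zero; suc; _≤_; _<_; z≤n; s≤s)
import Data.Nat.Properties as ℕ
open import Data.Product.Base using (∃-syntax; _×_; _,_; proj₁; proj₂)
open import Data.Sum.Base using (_⊎_; inj₁; inj₂)
open import Function.Bundles using (_⇔_; mk⇔; module Equivalence)
open import Relation.Binary.PropositionalEquality
open import Relation.Nullary.Decidable using (Dec; yes; no; toWitness; _×-dec_)
open import Relation.Nullary.Negation using (¬_; contradiction)

-- Coefficients in 𝔽₂ let the ring solver use p + p ≡ 0#.
constants : CommutativeRing.rawRing Bool.xor-∧-commutativeRing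
            -Raw-AlmostCommutative⟶ fromCommutativeRing +-*-commutativeRing
constants = record
  { ⟦_⟧    = _· 1#
  ; +-homo = λ a b → ·-distribʳ a b 1#
  ; *-homo = *-homo
  ; -‿homo = λ _ → refl
  ; 0-homo = refl
  ; 1-homo = refl
  }
  where
  *-homo : ∀ a b → (a ∧ b) · 1# ≡ (a · 1#) * (b · 1#)
  *-homo false b = refl
  *-homo true  b = refl

_≟-constant_ : ∀ a b → Maybe (a · 1# ≡ b · 1#)
false ≟-constant false = just refl
true  ≟-constant true  = just refl
_     ≟-constant _     = nothing

open Algebra.Solver.Ring (CommutativeRing.rawRing Bool.xor-∧-commutativeRing)
  (fromCommutativeRing +-*-commutativeRing) constants _≟-constant_
  using (solve; _:=_; _:+_; _:*_; con)

-- Divisibility and Euclid's lemma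

p+q≡0⇒p≡q : ∀ {p q} → p + q ≡ 0# → p ≡ q
p+q≡0⇒p≡q {p} {q} eq = begin
  p              ≡⟨ solve 2 (λ p q → p := (p :+ q) :+ q) refl p q ⟩
  (p + q) + q    ≡⟨ cong (_+ q) eq ⟩
  q              ∎
  where open ≡-Reasoning

swap-factors : ∀ p q r → p * (q * r) ≡ q * (p * r)
swap-factors = solve 3 (λ p q r → p :* (q :* r) := q :* (p :* r)) refl

-- Subtraction is addition over 𝔽₂, so p (q + r) = 0, and there are no zero divisors.
*-cancelˡ : ∀ {p q r} → p ≢ 0# → p * q ≡ p * r → q ≡ r
*-cancelˡ {0#}   p≢0 _  = contradiction refl p≢0
*-cancelˡ {nz p} {q} {r} _ eq = p+q≡0⇒p≡q (zero-factor (q + r) (begin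
  nz p * (q + r)        ≡⟨ *-distribˡ-+ (nz p) q r ⟩
  nz p * q + nz p * r   ≡⟨ cong (_+ nz p * r) eq ⟩
  nz p * r + nz p * r   ≡⟨ p+p≡0 (nz p * r) ⟩
  0#                    ∎))
  where
  open ≡-Reasoning
  zero-factor : ∀ s → nz p * s ≡ 0# → s ≡ 0#
  zero-factor 0#     _  = refl
  zero-factor (nz s) eq = contradiction eq (nz*nz≢0 p s)

*-≢0 : ∀ {p q} → p ≢ 0# → q ≢ 0# → p * q ≢ 0#
*-≢0 {0#}            p≢0 _   = contradiction refl p≢0
*-≢0 {nz _} {0#}     _   q≢0 = contradiction refl q≢0
*-≢0 {nz p} {nz q}   _   _   = nz*nz≢0 p q

*-≢0⁻ˡ : ∀ {p q} → p * q ≢ 0# → p ≢ 0#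
*-≢0⁻ˡ pq≢0 refl = pq≢0 refl

^-≢0 : ∀ {p} n → p ≢ 0# → p ^ n ≢ 0#
^-≢0 zero    _   ()
^-≢0 (suc n) p≢0 = *-≢0 p≢0 (^-≢0 n p≢0)

∣-refl : ∀ {p} → p ∣ p
∣-refl = 1# , refl

∣-trans : ∀ {p q r} → p ∣ q → q ∣ r → p ∣ r
∣-trans {p} (k , refl) (l , refl) = l * k , *-assoc l k p

∣-*ˡ : ∀ {p q} r → p ∣ q → p ∣ r * q
∣-*ˡ r (k , refl) = r * k , *-assoc r k _

∣-*ʳ : ∀ {p q} r → p ∣ q → p ∣ q * r
∣-*ʳ {q = q} r p∣q = subst (_ ∣_) (*-comm r q) (∣-*ˡ r p∣q)

∣-+ : ∀ {p q r} → p ∣ q → p ∣ r → p ∣ q + r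
∣-+ {p} (k , refl) (l , refl) = k + l , *-distribʳ-+ p k l

∣-+⁻ˡ : ∀ {p q r} → p ∣ q + r → p ∣ r → p ∣ q
∣-+⁻ˡ {q = q} {r} p∣q+r p∣r =
  subst (_ ∣_) (solve 2 (λ q r → (q :+ r) :+ r := q) refl q r) (∣-+ p∣q+r p∣r)

∣1⇒≡1 : ∀ {p} → p ∣ 1# → p ≡ 1#
∣1⇒≡1 {0#}          0∣1 = contradiction 0∣1 0∤1
∣1⇒≡1 {nz one}      _   = refl
∣1⇒≡1 {nz (a ∷ p)}  p∣1 with () ← ∣nz⇒deg≤ {nz (a ∷ p)} {one} p∣1

-- One more than the degree, and 0 for the zero polynomial. Thus `size r ≤ degNZ d` says that r is
-- zero or has smaller degree than d, which `deg` alone cannot express because it is 0 on 0.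
size : 𝔽₂[x] → ℕ
size 0#     = 0
size (nz p) = suc (degNZ p)

size-∷ₚ : ∀ a p → size (a ∷ₚ p) ≤ suc (size p)
size-∷ₚ false 0#     = z≤n
size-∷ₚ true  0#     = ℕ.≤-refl
size-∷ₚ a     (nz p) = ℕ.≤-refl

size-⊕ : ∀ p q → degNZ p ≡ degNZ q → size (p ⊕ q) ≤ degNZ q
size-⊕ one     one     _  = z≤n
size-⊕ (a ∷ p) (b ∷ q) eq =
  ℕ.≤-trans (size-∷ₚ (a xor b) (p ⊕ q)) (s≤s (size-⊕ p q (ℕ.suc-injective eq)))

-- Long division along the coefficients of p: if r is the remainder of p, then a + x r is congruent
-- to a + x p and exceeds the allowed degree by at most one.
divMod : ∀ d p → ∃[ k ] ∃[ r ] p ≡ k * nz d + r × size r ≤ degNZ d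
divMod d = 𝔽₂[x]-ind _ (0# , 0# , refl , z≤n) step
  where
  q = nz d
  step : ∀ a p → ∃[ k ] ∃[ r ] p ≡ k * q + r × size r ≤ degNZ d →
         ∃[ k ] ∃[ r ] a ∷ₚ p ≡ k * q + r × size r ≤ degNZ d
  step a p (k , r , refl , r≤d) = reduce (a ∷ₚ r) refl (ℕ.≤-trans (size-∷ₚ a r) (s≤s r≤d))
    where
    open ≡-Reasoning
    shifted : a ∷ₚ (k * q + r) ≡ (X * k) * q + (a ∷ₚ r)
    shifted = begin
      a ∷ₚ (k * q + r)          ≡⟨ ∷ₚ-+ false a (k * q) r ⟨
      X * (k * q) + (a ∷ₚ r)    ≡⟨ cong (_+ (a ∷ₚ r)) (*-assoc X k q) ⟨
      (X * k) * q + (a ∷ₚ r)    ∎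
    reduce : ∀ s → s ≡ a ∷ₚ r → size s ≤ suc (degNZ d) →
             ∃[ k ] ∃[ r ] a ∷ₚ p ≡ k * q + r × size r ≤ degNZ d
    reduce 0# eq _ = X * k , 0# , trans shifted (cong ((X * k) * q +_) (sym eq)) , z≤n
    reduce (nz s) eq (s≤s s≤d) with ℕ.m≤n⇒m<n∨m≡n s≤d
    ... | inj₁ s<d = X * k , nz s , trans shifted (cong ((X * k) * q +_) (sym eq)) , s<d
    -- Both leading coefficients are 1, so a single subtraction of d lowers the degree.
    ... | inj₂ s≡d = X * k + 1# , s ⊕ d , (begin
      a ∷ₚ (k * q + r)                ≡⟨ shifted ⟩
      (X * k) * q + (a ∷ₚ r)          ≡⟨ cong ((X * k) * q +_) eq ⟨
      (X * k) * q + nz s              ≡⟨ lemma (X * k) q (nz s) ⟩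
      (X * k + 1#) * q + (nz s + q)   ∎) , size-⊕ s d s≡d
      where
      lemma : ∀ k q s → k * q + s ≡ (k + 1#) * q + (s + q)
      lemma = solve 3 (λ k q s → k :* q :+ s := (k :+ con true) :* q :+ (s :+ q)) refl

-- The Euclidean algorithm. The fuel n bounds the size of the second argument, which is replaced by
-- a strictly smaller remainder.
bezout : ∀ n p q → size q ≤ n → ∃[ g ] ∃[ u ] ∃[ v ] g ∣ p × g ∣ q × g ≡ u * p + v * q
bezout n       p 0#     _ = p , 1# , 0# , ∣-refl , (0# , refl) , sym (+-identityʳ p)
bezout (suc n) p (nz d) (s≤s d≤n) with divMod d p
... | k , r , refl , r≤d with bezout n (nz d) r (ℕ.≤-trans r≤d d≤n)
...   | g , u , v , g∣q , g∣r , refl =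
  g , v , u + v * k , ∣-+ (∣-*ˡ k g∣q) g∣r , g∣q , lemma u v k (nz d) r
  where
  lemma : ∀ u v k q r → u * q + v * r ≡ v * (k * q + r) + (u + v * k) * q
  lemma = solve 5 (λ u v k q r →
    u :* q :+ v :* r := v :* (k :* q :+ r) :+ (u :+ v :* k) :* q) refl

module _ {P : 𝔽₂[x]} (irr : Irreducible P) where

  open Irreducible irr

  irreducible-≢0 : P ≢ 0#
  irreducible-≢0 refl with split-∣1 {0#} {0#} refl
  ... | inj₁ 0∣1 = 0∤1 0∣1
  ... | inj₂ 0∣1 = 0∤1 0∣1

  irreducible-≢1 : P ≢ 1#
  irreducible-≢1 P≡1 = p∤1 (subst (_∣ 1#) (sym P≡1) ∣-refl)

  irreducible-factor : ∀ {d} → d ∣ P → d ≡ 1# ⊎ d ≡ P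
  irreducible-factor {d} (k , k*d≡P) with split-∣1 {k} {d} (sym k*d≡P)
  ... | inj₂ d∣1 = inj₁ (∣1⇒≡1 d∣1)
  ... | inj₁ k∣1 = inj₂ (trans (cong (_* d) (sym (∣1⇒≡1 k∣1))) k*d≡P)

  -- The greatest common divisor of P and f is 1 or P, and P does not divide f. Multiplying 1 = u P
  -- + v f by h exhibits h as a multiple of P.
  euclid : ∀ {f h} → P ∤ f → P ∣ f * h → P ∣ h
  euclid {f} {h} P∤f (k , k*P≡fh) with bezout (size f) P f ℕ.≤-refl
  ... | g , u , v , g∣P , g∣f , g≡ with irreducible-factor g∣P
  ...   | inj₂ refl = contradiction g∣f P∤f
  ...   | inj₁ refl = u * h + v * k , (begin
    (u * h + v * k) * P
      ≡⟨ solve 5 (λ u v h k P → (u :* h :+ v :* k) :* P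
           := u :* h :* P :+ v :* (k :* P)) refl u v h k P ⟩
    u * h * P + v * (k * P)    ≡⟨ cong (λ w → u * h * P + v * w) k*P≡fh ⟩
    u * h * P + v * (f * h)
      ≡⟨ solve 5 (λ u v h f P → u :* h :* P :+ v :* (f :* h)
           := (u :* P :+ v :* f) :* h) refl u v h f P ⟩
    (u * P + v * f) * h        ≡⟨ cong (_* h) g≡ ⟨
    h                          ∎)
    where open ≡-Reasoning

  ∤-* : ∀ {f h} → P ∤ f → P ∤ h → P ∤ f * h
  ∤-* P∤f P∤h P∣fh = P∤h (euclid P∤f P∣fh)

  ∣*⇒∣⊎∣ : ∀ {f h} → P ∣ f * h → P ∣ f ⊎ P ∣ h
  ∣*⇒∣⊎∣ {f} P∣fh with P ∣? f
  ... | yes P∣f = inj₁ P∣f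
  ... | no  P∤f = inj₂ (euclid P∤f P∣fh)

  ∤-^ : ∀ {f} n → P ∤ f → P ∤ f ^ n
  ∤-^ zero    _   = p∤1
  ∤-^ (suc n) P∤f = ∤-* P∤f (∤-^ n P∤f)

  -- In k r = P^(n+1) f Euclid's lemma puts P into k, so one factor P can be cancelled at a time.
  -- Only P has to be irreducible.
  ∤-cancelˡ : ∀ {r f} n → P ∤ r → r ∣ P ^ n * f → r ∣ f
  ∤-cancelˡ zero _ r∣f = r∣f
  ∤-cancelˡ {r} {f} (suc n) P∤r (k , kr≡) with euclid P∤r
    (P ^ n * f , trans (*-comm (P ^ n * f) P)
    (trans (sym (*-assoc P (P ^ n) f)) (trans (sym kr≡) (*-comm k r))))
  ... | l , refl = ∤-cancelˡ n P∤r (l , *-cancelˡ irreducible-≢0 (begin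
    P * (l * r)       ≡⟨ solve 3 (λ P l r → P :* (l :* r) := (l :* P) :* r) refl P l r ⟩
    (l * P) * r       ≡⟨ kr≡ ⟩
    P * P ^ n * f     ≡⟨ *-assoc P (P ^ n) f ⟩
    P * (P ^ n * f)   ∎))
    where open ≡-Reasoning

  ^∣-cancelˡ : ∀ {f h} n → P ∤ f → P ^ n ∣ f * h → P ^ n ∣ h
  ^∣-cancelˡ {h = h} zero _ _ = h , *-comm h 1#
  ^∣-cancelˡ {f} {h} (suc n) P∤f (k , eq) = step
    (euclid P∤f (k * P ^ n , trans (rearrange k (P ^ n) P) eq))
    where
    open ≡-Reasoning
    rearrange : ∀ p q r → p * q * r ≡ p * (r * q)
    rearrange = solve 3 (λ p q r → p :* q :* r := p :* (r :* q)) refl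
    step : P ∣ h → P ^ suc n ∣ h
    step (l , refl) = extend (^∣-cancelˡ {h = l} n P∤f (k , *-cancelˡ irreducible-≢0 (begin
      P * (k * P ^ n)   ≡⟨ *-comm P (k * P ^ n) ⟩
      k * P ^ n * P     ≡⟨ rearrange k (P ^ n) P ⟩
      k * (P * P ^ n)   ≡⟨ eq ⟩
      f * (l * P)       ≡⟨ *-assoc f l P ⟨
      f * l * P         ≡⟨ *-comm (f * l) P ⟩
      P * (f * l)       ∎)))
      where
      extend : P ^ n ∣ l → P ^ suc n ∣ l * P
      extend (m , refl) = m , sym (rearrange m (P ^ n) P)

  -- The tool by which equations between products are turned into equations between exponents.
  valuation-unique : ∀ m n {f h} → P ∤ f → P ∤ h → P ^ m * f ≡ P ^ n * h → m ≡ n × f ≡ h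
  valuation-unique zero zero _ _ eq = refl , eq
  valuation-unique zero (suc n) {h = h} P∤f _ refl = contradiction (∣-*ʳ h (∣-*ʳ (P ^ n) ∣-refl)) P∤f
  valuation-unique (suc m) zero {f} _ P∤h refl = contradiction (∣-*ʳ f (∣-*ʳ (P ^ m) ∣-refl)) P∤h
  valuation-unique (suc m) (suc n) {f} {h} P∤f P∤h eq
    with valuation-unique m n P∤f P∤h (*-cancelˡ irreducible-≢0
      (trans (sym (*-assoc P (P ^ m) f)) (trans eq (*-assoc P (P ^ n) h))))
  ... | refl , f≡h = refl , f≡h

  -- Factors P are moved from d into `P ^ i` until P no longer divides what is left or all n of them
  -- are used up; in either case the rest divides f.
  divisor-of-^* : ∀ n {d f} → d ∣ P ^ n * f → ∃[ i ] ∃[ e ] d ≡ P ^ i * e × e ∣ f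
  divisor-of-^* zero {d} d∣ = 0 , d , refl , d∣
  divisor-of-^* (suc n) {d} {f} (k , eq) = split (P ∣? d)
    where
    open ≡-Reasoning
    split : Dec (P ∣ d) → ∃[ i ] ∃[ e ] d ≡ P ^ i * e × e ∣ f
    split (no  P∤d)        = 0 , d , refl , ∤-cancelˡ (suc n) P∤d (k , eq)
    split (yes (l , refl)) = extend (divisor-of-^* n {l} {f} (k , *-cancelˡ irreducible-≢0 (begin
      P * (k * l)        ≡⟨ *-comm P (k * l) ⟩
      k * l * P          ≡⟨ *-assoc k l P ⟩
      k * (l * P)        ≡⟨ eq ⟩
      P * P ^ n * f      ≡⟨ *-assoc P (P ^ n) f ⟩
      P * (P ^ n * f)    ∎)))
      where
      extend : ∃[ i ] ∃[ e ] l ≡ P ^ i * e × e ∣ f → ∃[ i ] ∃[ e ] l * P ≡ P ^ i * e × e ∣ f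
      extend (i , e , refl , e∣f) =
        suc i , e , solve 3 (λ P Q e → Q :* e :* P := P :* Q :* e) refl P (P ^ i) e , e∣f

-- Exact prime powers and existence of irreducible divisors

distinct-irreducibles : ∀ {P Q} → Irreducible P → Irreducible Q → P ≢ Q → P ∤ Q
distinct-irreducibles irrP irrQ P≢Q P∣Q with irreducible-factor irrQ P∣Q
... | inj₁ P≡1 = irreducible-≢1 irrP P≡1
... | inj₂ P≡Q = P≢Q P≡Q

degree-≥1 : ∀ {P} → Irreducible P → 0 < deg P
degree-≥1 {0#}         irr = contradiction refl (irreducible-≢0 irr)
degree-≥1 {nz one}     irr = contradiction refl (irreducible-≢1 irr)
degree-≥1 {nz (_ ∷ _)} _   = s≤s z≤n

quotient-degree-< : ∀ p q → 0 < deg p → q * p ≢ 0# → deg q < deg (q * p)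
quotient-degree-< 0#     _      () _
quotient-degree-< (nz p) 0#     _   0≢0 = contradiction refl 0≢0
quotient-degree-< (nz p) (nz q) 0<p _   =
  ℕ.≤-trans (ℕ.≤-reflexive (sym (ℕ.+-comm (degNZ q) 1)))
    (ℕ.≤-trans (ℕ.+-monoʳ-≤ (degNZ q) 0<p) (deg-* q p))

-- Each division by P lowers the degree, so the bound n on the degree serves as fuel.
extract-power : ∀ {P} → Irreducible P → ∀ n M → deg M ≤ n → M ≢ 0# →
  ∃[ k ] ∃[ N ] M ≡ P ^ k * N × P ∤ N
extract-power {P} irr n M M≤n M≢0 with P ∣? M
... | no P∤M = 0 , M , refl , P∤M
... | yes (N , refl) with n | ℕ.≤-trans (quotient-degree-< P N (degree-≥1 irr) M≢0) M≤n
...   | suc n | s≤s N≤n with extract-power irr n N N≤n (*-≢0⁻ˡ M≢0)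
...     | k , N′ , refl , P∤N′ =
  suc k , N′ , solve 3 (λ P Q N → Q :* N :* P := P :* Q :* N) refl P (P ^ k) N′ , P∤N′

-- Either M has a divisor of positive, strictly smaller degree, to which the recursion applies, or M
-- is itself irreducible.
irreducible-divisor : ∀ n M → deg M ≤ n → 0 < deg M → ∃[ P ] Irreducible P × P ∣ M
irreducible-divisor n 0# _ ()
irreducible-divisor n (nz M) M≤n 0<M
  with ∃deg? (λ d → (d ∣? nz M) ×-dec ((0 ℕ.<? deg d) ×-dec (deg d ℕ.<? degNZ M))) (degNZ M)
    (λ (_ , _ , d<M) → d<M)
irreducible-divisor zero    (nz M) M≤n 0<M | yes (d , d∣M , 0<d , d<M) =
  contradiction (ℕ.≤-trans d<M M≤n) λ ()
irreducible-divisor (suc n) (nz M) M≤n 0<M | yes (d , d∣M , 0<d , d<M)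
  with irreducible-divisor n d (ℕ.≤-pred (ℕ.≤-trans d<M M≤n)) 0<d
... | P , irr , P∣d = P , irr , ∣-trans P∣d d∣M
irreducible-divisor n (nz M) M≤n 0<M | no none = nz M , mkIrred
  (λ M∣1 → contradiction (subst (λ p → 0 < deg p) (∣1⇒≡1 M∣1) 0<M) λ ())
  split , ∣-refl
  where
  split : ∀ {x y} → nz M ≡ x * y → x ∣ 1# ⊎ y ∣ 1#
  split {0#} ()
  split {nz one} _ = inj₁ ∣-refl
  split {nz (a ∷ x)} {y} eq with ∣nz⇒deg≤ {nz (a ∷ x)} {M} (y , trans (*-comm y _) (sym eq))
  ... | x≤M with ℕ.m≤n⇒m<n∨m≡n x≤M
  ...   | inj₁ x<M = contradiction (nz (a ∷ x) , (y , trans (*-comm y _) (sym eq)) , s≤s z≤n , x<M) none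
  split {nz (a ∷ x)} {0#} eq | _ | inj₂ x≡M with () ← trans eq (*-zeroʳ (nz (a ∷ x)))
  split {nz (a ∷ x)} {nz one} _ | _ | inj₂ _ = inj₂ ∣-refl
  -- The factor x already has the full degree of M, so y cannot have positive degree.
  split {nz (a ∷ x)} {nz (b ∷ y)} eq | _ | inj₂ x≡M =
    contradiction (ℕ.≤-trans (deg-* (a ∷ x) (b ∷ y))
      (ℕ.≤-reflexive (trans (cong deg (sym eq)) (sym x≡M))))
      (ℕ.m+1+n≰m (suc (degNZ x)))

-- Multiplicativity of σ*

sum : List 𝔽₂[x] → 𝔽₂[x]
sum = foldr _+_ 0#

sum-↭ : ∀ {ps qs} → ps ↭ qs → sum ps ≡ sum qs
sum-↭ ps↭qs = foldr-commMonoid (setoid 𝔽₂[x])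
  (CommutativeRing.+-isCommutativeMonoid +-*-commutativeRing) (↭⇒↭ₛ ps↭qs)

sum-++ : ∀ ps qs → sum (ps ++ qs) ≡ sum ps + sum qs
sum-++ []       qs = refl
sum-++ (p ∷ ps) qs = trans (cong (p +_) (sum-++ ps qs)) (sym (+-assoc p _ _))

sum-map-* : ∀ c ps → sum (map (c *_) ps) ≡ c * sum ps
sum-map-* c []       = sym (*-zeroʳ c)
sum-map-* c (p ∷ ps) = trans (cong (c * p +_) (sum-map-* c ps)) (sym (*-distribˡ-+ c p _))

-- Serves to bound `ω` from below by listing distinct prime factors. The head of xs is deleted from
-- ys, and the tail still embeds because it avoids the head.
unique-⊆⇒length≤ : ∀ {A : Set} {xs ys : List A} → Unique xs → (∀ {x} → x ∈ xs → x ∈ ys) →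
  length xs ≤ length ys
unique-⊆⇒length≤ [] _ = z≤n
unique-⊆⇒length≤ {A} {xs = x ∷ xs} (x≢xs ∷ xs!) xs⊆ys with ∈-∃++ (xs⊆ys (here refl))
... | ys₁ , ys₂ , refl = ℕ.≤-trans (s≤s (unique-⊆⇒length≤ xs! xs⊆))
  (ℕ.≤-reflexive (sym (length-++-sucʳ ys₁ x ys₂)))
  where
  xs⊆ : ∀ {z} → z ∈ xs → z ∈ ys₁ ++ ys₂
  xs⊆ z∈xs with ∈-++⁻ ys₁ (xs⊆ys (there z∈xs))
  ... | inj₁ z∈ys₁         = ∈-++⁺ˡ z∈ys₁
  ... | inj₂ (here refl)   = contradiction refl (All.lookup x≢xs z∈xs)
  ... | inj₂ (there z∈ys₂) = ∈-++⁺ʳ ys₁ z∈ys₂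

≢0⇒monic : ∀ {p} → p ≢ 0# → Monic p
≢0⇒monic {0#}   p≢0 = contradiction refl p≢0
≢0⇒monic {nz p} _   = coeffNZ-deg p

module _ {P : 𝔽₂[x]} (irr : Irreducible P) {M : 𝔽₂[x]} (P∤M : P ∤ M) (M≢0 : M ≢ 0#) where

  private
    P≢0 = irreducible-≢0 irr

  -- By coprimality P cannot divide both a unitary divisor of P^a M and its cofactor, so P^a lies
  -- entirely in one of them: the unitary divisors are those of M together with their multiples by
  -- P^a.
  σ*-^* : ∀ a → 0 < a → σ* (P ^ a * M) ≡ (1# + P ^ a) * σ* M
  σ*-^* (suc a-1) _ = begin
    σ* (Pᵃ * M)
      -- Both lists are free of duplicates and have the same members, hence are permutations of each
      -- other.
      ≡⟨ sum-↭ (∼bag⇒↭ (unique∧set⇒bag (unitaryDivisors-unique (Pᵃ * M)) ds!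
           (mk⇔ (λ d∈ → to (Equivalence.to (∈-unitaryDivisors PᵃM≢0) d∈))
                (λ d∈ → Equivalence.from (∈-unitaryDivisors PᵃM≢0) (from d∈))))) ⟩
    sum (ds ++ map (Pᵃ *_) ds)
      ≡⟨ sum-++ ds _ ⟩
    sum ds + sum (map (Pᵃ *_) ds)
      ≡⟨ cong (sum ds +_) (sum-map-* Pᵃ ds) ⟩
    sum ds + Pᵃ * sum ds
      ≡⟨ *-distribʳ-+ (sum ds) 1# Pᵃ ⟨
    (1# + Pᵃ) * sum ds ∎
    where
    open ≡-Reasoning
    a = suc a-1
    Pᵃ = P ^ a
    ds = unitaryDivisors M
    PᵃM≢0 : Pᵃ * M ≢ 0#
    PᵃM≢0 = *-≢0 (^-≢0 a P≢0) M≢0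
    P∣Pᵃ : P ∣ Pᵃ
    P∣Pᵃ = ∣-*ʳ (P ^ a-1) ∣-refl
    ∈ds : ∀ {d} → d ∈ ds ⇔ UnitaryDivisor M d
    ∈ds = ∈-unitaryDivisors M≢0
    P∤ds : ∀ {d} → d ∈ ds → P ∤ d
    P∤ds d∈ P∣d with Equivalence.to ∈ds d∈
    ... | _ , q , qd≡M , _ = P∤M (∣-trans P∣d (q , qd≡M))
    ds! : Unique (ds ++ map (Pᵃ *_) ds)
    ds! = Unique.++⁺ (unitaryDivisors-unique M)
      (Unique.map⁺ (*-cancelˡ (^-≢0 a P≢0)) (unitaryDivisors-unique M))
      λ { (d∈ , d∈′) → disjoint d∈ (∈-map⁻ (Pᵃ *_) d∈′) }
      where
      disjoint : ∀ {d} → d ∈ ds → ¬ (∃[ e ] e ∈ ds × d ≡ Pᵃ * e)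
      disjoint d∈ (e , _ , refl) = P∤ds d∈ (∣-*ʳ e P∣Pᵃ)
    to : ∀ {d} → UnitaryDivisor (Pᵃ * M) d → d ∈ ds ++ map (Pᵃ *_) ds
    to {d} (monic , q , qd≡PᵃM , coprime) = split (P ∣? d)
      where
      split : Dec (P ∣ d) → d ∈ ds ++ map (Pᵃ *_) ds
      split (no P∤d) = left (^∣-cancelˡ irr {d} {q} a P∤d
        (M , trans (*-comm M Pᵃ) (trans (sym qd≡PᵃM) (*-comm q d))))
        where
        left : Pᵃ ∣ q → d ∈ ds ++ map (Pᵃ *_) ds
        left (q′ , q′Pᵃ≡q) = ∈-++⁺ˡ (Equivalence.from ∈ds (monic , q′ ,
          *-cancelˡ (^-≢0 a P≢0) (begin
            Pᵃ * (q′ * d)   ≡⟨ *-assoc Pᵃ q′ d ⟨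
            Pᵃ * q′ * d     ≡⟨ cong (_* d) (*-comm Pᵃ q′) ⟩
            q′ * Pᵃ * d     ≡⟨ cong (_* d) q′Pᵃ≡q ⟩
            q * d           ≡⟨ qd≡PᵃM ⟩
            Pᵃ * M          ∎) ,
          λ {r} r∣d r∣q′ → coprime {r} r∣d (subst (r ∣_) q′Pᵃ≡q (∣-*ʳ Pᵃ r∣q′))))
      split (yes P∣d) = right (^∣-cancelˡ irr {q} {d} a
        (λ P∣q → irreducible-≢1 irr (∣1⇒≡1 (coprime {P} P∣d P∣q)))
          (M , trans (*-comm M Pᵃ) (sym qd≡PᵃM)))
        where
        right : Pᵃ ∣ d → d ∈ ds ++ map (Pᵃ *_) ds
        right (d′ , d′Pᵃ≡d) = ∈-++⁺ʳ ds
          (subst (_∈ map (Pᵃ *_) ds) (trans (*-comm Pᵃ d′) d′Pᵃ≡d) (∈-map⁺ (Pᵃ *_)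
          (Equivalence.from ∈ds (≢0⇒monic {d′}
            (λ { refl → contradiction (subst Monic (sym d′Pᵃ≡d) monic) λ () }) , q ,
            *-cancelˡ (^-≢0 a P≢0) (begin
              Pᵃ * (q * d′)   ≡⟨ swap-factors Pᵃ q d′ ⟩
              q * (Pᵃ * d′)   ≡⟨ cong (q *_) (trans (*-comm Pᵃ d′) d′Pᵃ≡d) ⟩
              q * d           ≡⟨ qd≡PᵃM ⟩
              Pᵃ * M          ∎) ,
            λ {r} r∣d′ r∣q → coprime {r} (subst (r ∣_) d′Pᵃ≡d (∣-*ʳ Pᵃ r∣d′)) r∣q))))
    from : ∀ {d} → d ∈ ds ++ map (Pᵃ *_) ds → UnitaryDivisor (Pᵃ * M) d
    from {d} d∈ with ∈-++⁻ ds d∈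
    ... | inj₁ d∈ds with Equivalence.to ∈ds d∈ds
    ...   | monic , q , qd≡M , coprime = monic , Pᵃ * q , trans (*-assoc Pᵃ q d) (cong (Pᵃ *_) qd≡M) ,
            λ {r} r∣d r∣Pᵃq → coprime {r} r∣d
              (∤-cancelˡ irr a (λ P∣r → P∤ds d∈ds (∣-trans P∣r r∣d)) r∣Pᵃq)
    from {d} d∈ | inj₂ d∈Pᵃds with ∈-map⁻ (Pᵃ *_) d∈Pᵃds
    ... | e , e∈ds , refl with Equivalence.to ∈ds e∈ds
    ...   | monic , q , qe≡M , coprime = ≢0⇒monic
      (*-≢0 (^-≢0 a P≢0) (λ { refl → contradiction monic λ () })) , q ,
            trans (solve 3 (λ Q q e → q :* (Q :* e) := Q :* (q :* e)) refl Pᵃ q e) (cong (Pᵃ *_) qe≡M) ,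
            λ {r} r∣Pᵃe r∣q → coprime {r} (∤-cancelˡ irr a
              (λ P∣r → P∤M (∣-trans P∣r (∣-trans r∣q (e , trans (*-comm e q) qe≡M)))) r∣Pᵃe) r∣q

-- Formal derivative and substitution

∷ₚ≡ : ∀ a p → a ∷ₚ p ≡ a · 1# + X * p
∷ₚ≡ false 0#     = refl
∷ₚ≡ true  0#     = refl
∷ₚ≡ false (nz p) = refl
∷ₚ≡ true  (nz p) = refl

D : 𝔽₂[x] → 𝔽₂[x]
D 0#           = 0#
D (nz one)     = 0#
D (nz (_ ∷ p)) = nz p + X * D (nz p)

D-∷ₚ : ∀ a p → D (a ∷ₚ p) ≡ p + X * D p
D-∷ₚ false 0#     = refl
D-∷ₚ true  0#     = refl
D-∷ₚ a     (nz p) = refl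

-- The double induction shared by the derivative and by substitution; only the step at a + x p
-- differs.
additive : ∀ F → F 0# ≡ 0# →
  (∀ a b p q → F (p + q) ≡ F p + F q → F ((a xor b) ∷ₚ (p + q)) ≡ F (a ∷ₚ p) + F (b ∷ₚ q)) →
  ∀ p q → F (p + q) ≡ F p + F q
additive F F0≡0 step = 𝔽₂[x]-ind _
  (λ q → cong (_+ F q) (sym F0≡0))
  (λ a p ih → 𝔽₂[x]-ind _
    (trans (cong F (+-identityʳ (a ∷ₚ p))) (sym (trans (cong (F (a ∷ₚ p) +_) F0≡0) (+-identityʳ _))))
    (λ b q _ → trans (cong F (∷ₚ-+ a b p q)) (step a b p q (ih q))))

distribute : ∀ x p q r s → (p + q) + x * (r + s) ≡ (p + x * r) + (q + x * s)
distribute = solve 5 (λ x p q r s → (p :+ q) :+ x :* (r :+ s) := (p :+ x :* r) :+ (q :+ x :* s)) refl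

D-+ : ∀ p q → D (p + q) ≡ D p + D q
D-+ = additive D refl λ a b p q ih → begin
  D ((a xor b) ∷ₚ (p + q))        ≡⟨ D-∷ₚ (a xor b) (p + q) ⟩
  (p + q) + X * D (p + q)         ≡⟨ cong (λ r → (p + q) + X * r) ih ⟩
  (p + q) + X * (D p + D q)       ≡⟨ distribute X p q (D p) (D q) ⟩
  (p + X * D p) + (q + X * D q)   ≡⟨ cong₂ _+_ (D-∷ₚ a p) (D-∷ₚ b q) ⟨
  D (a ∷ₚ p) + D (b ∷ₚ q)         ∎
  where open ≡-Reasoning

D-· : ∀ a p → D (a · p) ≡ a · D p
D-· false p = refl
D-· true  p = refl

D-* : ∀ p q → D (p * q) ≡ D p * q + p * D q
D-* p q = 𝔽₂[x]-ind (λ p → D (p * q) ≡ D p * q + p * D q) refl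
  (λ a p ih → begin
    D ((a ∷ₚ p) * q)
      ≡⟨ cong D (∷ₚ-* a p q) ⟩
    D (a · q + (false ∷ₚ p * q))
      ≡⟨ D-+ (a · q) _ ⟩
    D (a · q) + D (false ∷ₚ p * q)
      ≡⟨ cong₂ _+_ (D-· a q) (D-∷ₚ false (p * q)) ⟩
    a · D q + (p * q + X * D (p * q))
      ≡⟨ cong (λ r → a · D q + (p * q + X * r)) ih ⟩
    a · D q + (p * q + X * (D p * q + p * D q))
      ≡⟨ rearrange X (a · D q) p q (D p) (D q) ⟩
    (p + X * D p) * q + (a · D q + X * (p * D q))
      ≡⟨ cong₂ (λ r s → r * q + s) (D-∷ₚ a p) (∷ₚ-* a p (D q)) ⟨
    D (a ∷ₚ p) * q + (a ∷ₚ p) * D q ∎)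
  p
  where
  open ≡-Reasoning
  rearrange : ∀ x c p q r s → c + (p * q + x * (r * q + p * s)) ≡ (p + x * r) * q + (c + x * (p * s))
  rearrange = solve 6 (λ x c p q r s →
    c :+ (p :* q :+ x :* (r :* q :+ p :* s)) := (p :+ x :* r) :* q :+ (c :+ x :* (p :* s))) refl

-- Squares have derivative 0, so 1 + Y g² has derivative g².
squarefree : ∀ {Y Q} g → D Y ≡ 1# → Q * Q ∣ 1# + Y * (g * g) → Q ∣ 1#
squarefree {Y} {Q} g DY≡1 (k , kQ²≡) = k * Q + Y * D k * Q , (begin
  (k * Q + Y * D k * Q) * Q
    ≡⟨ solve 4 (λ k Q Y d → (k :* Q :+ Y :* d :* Q) :* Q
         := k :* (Q :* Q) :+ Y :* (d :* (Q :* Q))) refl k Q Y (D k) ⟩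
  k * (Q * Q) + Y * (D k * (Q * Q))   ≡⟨ cong₂ (λ r s → r + Y * s) kQ²≡ D≡ ⟩
  1# + Y * (g * g) + Y * (g * g)
    ≡⟨ solve 1 (λ r → con true :+ r :+ r := con true) refl (Y * (g * g)) ⟩
  1#                                  ∎)
  where
  open ≡-Reasoning
  D-square : ∀ p q → D (p * (q * q)) ≡ D p * (q * q)
  D-square p q = begin
    D (p * (q * q))                            ≡⟨ D-* p (q * q) ⟩
    D p * (q * q) + p * D (q * q)              ≡⟨ cong (λ r → D p * (q * q) + p * r) (D-* q q) ⟩
    D p * (q * q) + p * (D q * q + q * D q)
      ≡⟨ solve 4 (λ p q r s → r :* (q :* q) :+ p :* (s :* q :+ q :* s)
           := r :* (q :* q)) refl p q (D p) (D q) ⟩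
    D p * (q * q)                              ∎
  -- Differentiating `kQ²≡` expresses g² through Q². Eliminating g² gives 1 = (k + Y D k) Q², the
  -- origin of the witness above.
  D≡ : D k * (Q * Q) ≡ g * g
  D≡ = begin
    D k * (Q * Q)           ≡⟨ D-square k Q ⟨
    D (k * (Q * Q))         ≡⟨ cong D kQ²≡ ⟩
    D (1# + Y * (g * g))    ≡⟨ D-+ 1# (Y * (g * g)) ⟩
    D (Y * (g * g))         ≡⟨ D-square Y g ⟩
    D Y * (g * g)           ≡⟨ cong (_* (g * g)) DY≡1 ⟩
    g * g                   ∎

∷ₚ-∘ : ∀ a p q → (a ∷ₚ p) ∘ q ≡ a · 1# + q * (p ∘ q)
∷ₚ-∘ false 0#     q = sym (*-zeroʳ q)
∷ₚ-∘ true  0#     q = cong (1# +_) (sym (*-zeroʳ q))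
∷ₚ-∘ a     (nz p) q = refl

∘-+ : ∀ r p q → (p + q) ∘ r ≡ p ∘ r + q ∘ r
∘-+ r = additive (_∘ r) refl λ a b p q ih → begin
  ((a xor b) ∷ₚ (p + q)) ∘ r
    ≡⟨ ∷ₚ-∘ (a xor b) (p + q) r ⟩
  (a xor b) · 1# + r * ((p + q) ∘ r)
    ≡⟨ cong₂ (λ s t → s + r * t) (·-distribʳ a b 1#) ih ⟩
  (a · 1# + b · 1#) + r * (p ∘ r + q ∘ r)
    ≡⟨ distribute r (a · 1#) (b · 1#) (p ∘ r) (q ∘ r) ⟩
  (a · 1# + r * (p ∘ r)) + (b · 1# + r * (q ∘ r))
    ≡⟨ cong₂ _+_ (∷ₚ-∘ a p r) (∷ₚ-∘ b q r) ⟨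
  (a ∷ₚ p) ∘ r + (b ∷ₚ q) ∘ r ∎
  where open ≡-Reasoning

·-∘ : ∀ a p q → (a · p) ∘ q ≡ a · 1# * (p ∘ q)
·-∘ false p q = refl
·-∘ true  p q = refl

∘-* : ∀ r p q → (p * q) ∘ r ≡ (p ∘ r) * (q ∘ r)
∘-* r p q = 𝔽₂[x]-ind (λ p → (p * q) ∘ r ≡ (p ∘ r) * (q ∘ r)) refl
  (λ a p ih → begin
    ((a ∷ₚ p) * q) ∘ r
      ≡⟨ cong (_∘ r) (∷ₚ-* a p q) ⟩
    (a · q + (false ∷ₚ p * q)) ∘ r
      ≡⟨ ∘-+ r (a · q) _ ⟩
    (a · q) ∘ r + (false ∷ₚ p * q) ∘ r
      ≡⟨ cong₂ _+_ (·-∘ a q r) (∷ₚ-∘ false (p * q) r) ⟩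
    a · 1# * (q ∘ r) + r * ((p * q) ∘ r)
      ≡⟨ cong (λ s → a · 1# * (q ∘ r) + r * s) ih ⟩
    a · 1# * (q ∘ r) + r * ((p ∘ r) * (q ∘ r))
      ≡⟨ solve 4 (λ c q r p → c :* q :+ r :* (p :* q)
           := (c :+ r :* p) :* q) refl (a · 1#) (q ∘ r) r (p ∘ r) ⟩
    (a · 1# + r * (p ∘ r)) * (q ∘ r)
      ≡⟨ cong (_* (q ∘ r)) (∷ₚ-∘ a p r) ⟨
    ((a ∷ₚ p) ∘ r) * (q ∘ r) ∎)
  p
  where open ≡-Reasoning

∘-^ : ∀ r p n → (p ^ n) ∘ r ≡ (p ∘ r) ^ n
∘-^ r p zero    = refl
∘-^ r p (suc n) = trans (∘-* r p (p ^ n)) (cong ((p ∘ r) *_) (∘-^ r p n))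

∘[X+1]-involutive : ∀ p → (p ∘ (X + 1#)) ∘ (X + 1#) ≡ p
∘[X+1]-involutive = 𝔽₂[x]-ind _ refl λ a p ih → begin
  ((a ∷ₚ p) ∘ Z) ∘ Z                ≡⟨ cong (_∘ Z) (∷ₚ-∘ a p Z) ⟩
  (a · 1# + Z * (p ∘ Z)) ∘ Z        ≡⟨ ∘-+ Z (a · 1#) _ ⟩
  (a · 1#) ∘ Z + (Z * (p ∘ Z)) ∘ Z  ≡⟨ cong₂ _+_ (·-∘ a 1# Z) (∘-* Z Z (p ∘ Z)) ⟩
  a · 1# * 1# + X * ((p ∘ Z) ∘ Z)   ≡⟨ cong₂ (λ s t → s + X * t) (*-comm (a · 1#) 1#) ih ⟩
  a · 1# + X * p                    ≡⟨ ∷ₚ≡ a p ⟨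
  a ∷ₚ p                            ∎
  where
  open ≡-Reasoning
  Z = X + 1#

-- Frobenius and odd parts of exponents

parity : ∀ n → ∃[ j ] (n ≡ j ℕ.+ j ⊎ n ≡ suc (j ℕ.+ j))
parity zero = 0 , inj₁ refl
parity (suc n) with parity n
... | j , inj₁ refl = j , inj₂ refl
... | j , inj₂ refl = suc j , inj₁ (cong suc (sym (ℕ.+-suc j j)))

-- Odd numbers are written `suc (j ℕ.+ j)` because the half j supplies the square in Y^(2j+1) = Y
-- (Y^j)², which the squarefreeness argument needs.
odd-part : ∀ a → 0 < a → ∃[ k ] ∃[ j ] a ≡ suc (j ℕ.+ j) ℕ.* 2 ℕ.^ k
odd-part a = go a a ℕ.≤-refl
  where
  go : ∀ n a → a ≤ n → 0 < a → ∃[ k ] ∃[ j ] a ≡ suc (j ℕ.+ j) ℕ.* 2 ℕ.^ k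
  go n a a≤n 0<a with parity a
  go n _ a≤n 0<a | j , inj₂ refl = 0 , j , sym (ℕ.*-identityʳ _)
  go n _ a≤n ()  | zero , inj₁ refl
  go (suc n) _ (s≤s a≤n) 0<a | suc i , inj₁ refl
    with go n (suc i) (ℕ.≤-trans (s≤s (ℕ.m≤m+n i i))
      (ℕ.≤-trans (ℕ.≤-reflexive (sym (ℕ.+-suc i i))) a≤n)) (s≤s z≤n)
  ... | k , j , eq = suc k , j , (begin
    suc i ℕ.+ suc i                            ≡⟨ cong₂ ℕ._+_ eq eq ⟩
    u ℕ.* 2 ℕ.^ k ℕ.+ u ℕ.* 2 ℕ.^ k            ≡⟨ ℕ.*-distribˡ-+ u (2 ℕ.^ k) _ ⟨
    u ℕ.* (2 ℕ.^ k ℕ.+ 2 ℕ.^ k)                ≡⟨ cong (λ m → u ℕ.* (2 ℕ.^ k ℕ.+ m)) (ℕ.+-identityʳ _) ⟨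
    u ℕ.* 2 ℕ.^ suc k                          ∎)
    where
    open ≡-Reasoning
    u = suc (j ℕ.+ j)

2^n>0 : ∀ n → 0 < 2 ℕ.^ n
2^n>0 n = ℕ.m^n>0 2 n

^-2^suc : ∀ p n → p ^ (2 ℕ.^ suc n) ≡ p ^ (2 ℕ.^ n) * p ^ (2 ℕ.^ n)
^-2^suc p n = trans (cong (λ m → p ^ (2 ℕ.^ n ℕ.+ m)) (ℕ.+-identityʳ (2 ℕ.^ n)))
  (^-homo-* p (2 ℕ.^ n) (2 ℕ.^ n))

frobenius : ∀ n p q → (p + q) ^ (2 ℕ.^ n) ≡ p ^ (2 ℕ.^ n) + q ^ (2 ℕ.^ n)
frobenius zero p q = solve 2 (λ p q → (p :+ q) :* con true := p :* con true :+ q :* con true) refl p q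
frobenius (suc n) p q = begin
  (p + q) ^ (2 ℕ.^ suc n)                ≡⟨ ^-2^suc (p + q) n ⟩
  (p + q) ^ N * (p + q) ^ N              ≡⟨ cong₂ _*_ (frobenius n p q) (frobenius n p q) ⟩
  (p ^ N + q ^ N) * (p ^ N + q ^ N)
    ≡⟨ solve 2 (λ P Q → (P :+ Q) :* (P :+ Q) := P :* P :+ Q :* Q) refl (p ^ N) (q ^ N) ⟩
  p ^ N * p ^ N + q ^ N * q ^ N          ≡⟨ cong₂ _+_ (^-2^suc p n) (^-2^suc q n) ⟨
  p ^ (2 ℕ.^ suc n) + q ^ (2 ℕ.^ suc n)  ∎
  where
  open ≡-Reasoning
  N = 2 ℕ.^ n

1^ : ∀ n → 1# ^ n ≡ 1#
1^ zero    = refl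
1^ (suc n) = 1^ n

frobenius-1+ : ∀ n p → (1# + p) ^ (2 ℕ.^ n) ≡ 1# + p ^ (2 ℕ.^ n)
frobenius-1+ n p = trans (frobenius n 1# p) (cong (_+ p ^ (2 ℕ.^ n)) (1^ (2 ℕ.^ n)))

-- Reduces questions about the exponent u 2^k to the exponent u.
1+^-* : ∀ u k p → 1# + p ^ (u ℕ.* 2 ℕ.^ k) ≡ (1# + p ^ u) ^ (2 ℕ.^ k)
1+^-* u k p = trans (cong (1# +_) (sym (^-assocʳ p u (2 ℕ.^ k)))) (sym (frobenius-1+ k (p ^ u)))

1+p∣1+p^ : ∀ p n → 1# + p ∣ 1# + p ^ n
1+p∣1+p^ p zero    = 0# , refl
1+p∣1+p^ p (suc n) = subst (1# + p ∣_)
  (solve 2 (λ p q → (con true :+ p) :+ p :* (con true :+ q) := con true :+ p :* q) refl p (p ^ n))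
  (∣-+ ∣-refl (∣-*ˡ p (1+p∣1+p^ p n)))

1+p^∣1+p^* : ∀ p u m → 1# + p ^ u ∣ 1# + p ^ (u ℕ.* m)
1+p^∣1+p^* p u m = subst (λ q → 1# + p ^ u ∣ 1# + q) (^-assocʳ p u m) (1+p∣1+p^ (p ^ u) m)

^-odd : ∀ p j → p ^ suc (j ℕ.+ j) ≡ p * (p ^ j * p ^ j)
^-odd p j = cong (p *_) (^-homo-* p j j)

1+-injective : ∀ {p q} → 1# + p ≡ 1# + q → p ≡ q
1+-injective {p} {q} eq = trans (sym (drop p)) (trans (cong (1# +_) eq) (drop q))
  where
  drop : ∀ p → 1# + (1# + p) ≡ p
  drop = solve 1 (λ p → con true :+ (con true :+ p) := p) refl

module _ {P : 𝔽₂[x]} (irr : Irreducible P) where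

  ∣^⇒≡^ : ∀ n {d} → d ∣ P ^ n → ∃[ i ] d ≡ P ^ i
  ∣^⇒≡^ n {d} d∣ with divisor-of-^* irr n (subst (d ∣_) (*-comm 1# (P ^ n)) d∣)
  ... | i , e , refl , e∣1 = i , trans (cong (P ^ i *_) (∣1⇒≡1 e∣1)) (*-comm (P ^ i) 1#)

  ^-injective : ∀ m n → P ^ m ≡ P ^ n → m ≡ n
  ^-injective m n eq = proj₁ (valuation-unique irr m n {1#} {1#} (Irreducible.p∤1 irr)
    (Irreducible.p∤1 irr)
    (trans (*-comm (P ^ m) 1#) (trans eq (*-comm 1# (P ^ n)))))

  ∤1+ : ∀ {f} → P ∣ f → P ∤ 1# + f
  ∤1+ P∣f P∣1+f = Irreducible.p∤1 irr (∣-+⁻ˡ P∣1+f P∣f)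

  ∤1+^ : ∀ n → 0 < n → P ∤ 1# + P ^ n
  ∤1+^ (suc n) _ = ∤1+ (∣-*ʳ (P ^ n) ∣-refl)

  odd-power-exponent : ∀ j → P ^ suc (j ℕ.+ j) ≡ P → j ≡ 0
  odd-power-exponent j eq with j | ^-injective (suc (j ℕ.+ j)) 1 (trans eq (*-comm 1# P))
  ... | zero  | _ = refl
  ... | suc _ | ()

-- With g = P^j, 1 + P g² = (1 + P) + P (1 + g)², and 1 + P divides 1 + g.
odd-cofactor : ∀ P j → ∃[ T ] 1# + P ^ suc (j ℕ.+ j) ≡ (1# + P) * T × P * (1# + P) ∣ 1# + T
odd-cofactor P j with 1+p∣1+p^ P j
... | h , eq = 1# + P * (1# + P) * (h * h) , (begin
  1# + P ^ suc (j ℕ.+ j)                           ≡⟨ cong (1# +_) (^-odd P j) ⟩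
  1# + P * (g * g)
    ≡⟨ solve 2 (λ P g → con true :+ P :* (g :* g)
         := con true :+ P :+ P :* ((con true :+ g) :* (con true :+ g))) refl P g ⟩
  1# + P + P * ((1# + g) * (1# + g))               ≡⟨ cong (λ s → 1# + P + P * (s * s)) eq ⟨
  1# + P + P * ((h * (1# + P)) * (h * (1# + P)))
    ≡⟨ solve 2 (λ P h → con true :+ P :+ P :* ((h :* (con true :+ P)) :* (h :* (con true :+ P)))
         := (con true :+ P) :* (con true :+ P :* (con true :+ P) :* (h :* h))) refl P h ⟩
  (1# + P) * (1# + P * (1# + P) * (h * h))         ∎) ,
  (h * h , solve 2 (λ P h → h :* h :* (P :* (con true :+ P))
    := con true :+ (con true :+ P :* (con true :+ P) :* (h :* h))) refl P h)
  where
  open ≡-Reasoning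
  g = P ^ j

-- The residue field of X and of X + 1 is 𝔽₂: a remainder modulo a linear polynomial is 0 or 1.
linear-∣1+ : ∀ {a p} → nz (a ∷ one) ∤ p → nz (a ∷ one) ∣ 1# + p
linear-∣1+ {a} {p} ∤p with divMod (a ∷ one) p
... | k , 0# , refl , _ = contradiction (k , sym (+-identityʳ _)) ∤p
... | k , nz one , refl , _ = k , solve 1 (λ r → r
  := con true :+ (r :+ con true)) refl (k * nz (a ∷ one))
... | k , nz (_ ∷ _) , refl , s≤s ()

module _ {Y Z P : 𝔽₂[x]} (irrY : Irreducible Y) (irrZ : Irreducible Z) (irrP : Irreducible P)
         (Y≢Z : Y ≢ Z) (Y≢P : Y ≢ P) (Z≢P : Z ≢ P) where

  private
    Y∤Z = distinct-irreducibles irrY irrZ Y≢Z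
    Y∤P = distinct-irreducibles irrY irrP Y≢P
    Z∤P = distinct-irreducibles irrZ irrP Z≢P

  exponents-unique : ∀ a b c a′ b′ c′ → Y ^ a * (Z ^ b * P ^ c) ≡ Y ^ a′ * (Z ^ b′ * P ^ c′) →
                     a ≡ a′ × b ≡ b′ × c ≡ c′
  exponents-unique a b c a′ b′ c′ eq
    with valuation-unique irrY a a′ (∤-* irrY (∤-^ irrY b Y∤Z) (∤-^ irrY c Y∤P))
                                    (∤-* irrY (∤-^ irrY b′ Y∤Z) (∤-^ irrY c′ Y∤P)) eq
  ... | a≡a′ , eq₁ with valuation-unique irrZ b b′ (∤-^ irrZ c Z∤P) (∤-^ irrZ c′ Z∤P) eq₁
  ...   | b≡b′ , eq₂ = a≡a′ , b≡b′ , ^-injective irrP c c′ eq₂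

-- The prime factorisations of 1 + X^a, 1 + (X + 1)^b and 1 + P^c

irreducible-linear : ∀ a → Irreducible (nz (a ∷ one))
irreducible-linear false = toWitness {a? = irreducible? X} _
irreducible-linear true  = toWitness {a? = irreducible? (X + 1#)} _

-- Satisfied by X and X + 1, in either order.
record ComplementaryPair (Y Z : 𝔽₂[x]) : Set where
  field
    irrY  : Irreducible Y
    irrZ  : Irreducible Z
    Y≢Z   : Y ≢ Z
    1+Y≡Z : 1# + Y ≡ Z
    1+Z≡Y : 1# + Z ≡ Y
    DY≡1  : D Y ≡ 1#
    Y∣1+  : ∀ {p} → Y ∤ p → Y ∣ 1# + p
    Z∣1+  : ∀ {p} → Z ∤ p → Z ∣ 1# + p

  Y∤Z : Y ∤ Z
  Y∤Z = distinct-irreducibles irrY irrZ Y≢Z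

  Z∤Y : Z ∤ Y
  Z∤Y = distinct-irreducibles irrZ irrY (λ Z≡Y → Y≢Z (sym Z≡Y))

X,X+1 : ComplementaryPair X (X + 1#)
X,X+1 = record
  { irrY = irreducible-linear false ; irrZ = irreducible-linear true ; Y≢Z = λ ()
  ; 1+Y≡Z = refl ; 1+Z≡Y = refl ; DY≡1 = refl ; Y∣1+ = linear-∣1+ ; Z∣1+ = linear-∣1+ }

X+1,X : ComplementaryPair (X + 1#) X
X+1,X = record
  { irrY = irreducible-linear true ; irrZ = irreducible-linear false ; Y≢Z = λ ()
  ; 1+Y≡Z = refl ; 1+Z≡Y = refl ; DY≡1 = refl ; Y∣1+ = linear-∣1+ ; Z∣1+ = linear-∣1+ }

module _ {Y Z : 𝔽₂[x]} (pair : ComplementaryPair Y Z) where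

  open ComplementaryPair pair

  Z∣1+Y^ : ∀ n → Z ∣ 1# + Y ^ n
  Z∣1+Y^ n = subst (_∣ 1# + Y ^ n) 1+Y≡Z (1+p∣1+p^ Y n)

  1+Y^2^ : ∀ n → 1# + Y ^ (2 ℕ.^ n) ≡ Z ^ (2 ℕ.^ n)
  1+Y^2^ n = trans (sym (frobenius-1+ n Y)) (cong (_^ (2 ℕ.^ n)) 1+Y≡Z)

  1+Z^2^ : ∀ n → 1# + Z ^ (2 ℕ.^ n) ≡ Y ^ (2 ℕ.^ n)
  1+Z^2^ n = trans (sym (frobenius-1+ n Z)) (cong (_^ (2 ℕ.^ n)) 1+Z≡Y)

  -- With i at least 2 the square of Q would divide 1 + Y (Y^j)², which is squarefree.
  squarefree-exponent : ∀ {Q} → Irreducible Q → ∀ j i {e} →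
    Q ^ i * e ≡ 1# + Y ^ suc (j ℕ.+ j) → i ≡ 0 ⊎ i ≡ 1
  squarefree-exponent irrQ j 0 _ = inj₁ refl
  squarefree-exponent irrQ j 1 _ = inj₂ refl
  squarefree-exponent {Q} irrQ j (suc (suc i)) {e} eq = contradiction
    (squarefree {Y} (Y ^ j) DY≡1 (Q ^ i * e , (begin
      Q ^ i * e * (Q * Q)
        ≡⟨ solve 3 (λ Q R e → R :* e :* (Q :* Q) := Q :* (Q :* R) :* e) refl Q (Q ^ i) e ⟩
      Q ^ suc (suc i) * e        ≡⟨ eq ⟩
      1# + Y ^ suc (j ℕ.+ j)     ≡⟨ cong (1# +_) (^-odd Y j) ⟩
      1# + Y * (Y ^ j * Y ^ j)   ∎)))
    (Irreducible.p∤1 irrQ)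
    where open ≡-Reasoning

  1+Y^≡Z⇒ : ∀ j → 1# + Y ^ suc (j ℕ.+ j) ≡ Z → j ≡ 0
  1+Y^≡Z⇒ j eq = odd-power-exponent irrY j (1+-injective (trans eq (sym 1+Y≡Z)))

  -- The divisor is a power of Z, squarefree, and divisible by Z, hence equal to Z = 1 + Y; this
  -- makes the odd exponent 1.
  odd∣Z^ : ∀ j g → 1# + Y ^ suc (j ℕ.+ j) ∣ Z ^ g → j ≡ 0
  odd∣Z^ j g 1+Yᵘ∣ with ∣^⇒≡^ irrZ g 1+Yᵘ∣
  ... | i , eq with squarefree-exponent irrZ j i (trans (*-comm (Z ^ i) 1#) (sym eq))
  ...   | inj₁ refl = contradiction (subst (Z ∣_) eq (Z∣1+Y^ (suc (j ℕ.+ j)))) (Irreducible.p∤1 irrZ)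
  ...   | inj₂ refl = 1+Y^≡Z⇒ j (trans eq (*-comm Z 1#))

  -- If u is the odd part of n, then 1 + Y^u divides 1 + Y^n and is prime to Y, so it divides a
  -- power of Z.
  ∣Y^*Z^⇒2^ : ∀ n → 0 < n → ∀ a b → 1# + Y ^ n ∣ Y ^ a * Z ^ b → ∃[ s ] n ≡ 2 ℕ.^ s
  ∣Y^*Z^⇒2^ n 0<n a b 1+Yⁿ∣ = conclude (odd-part n 0<n)
    where
    conclude : ∃[ s ] ∃[ j ] n ≡ suc (j ℕ.+ j) ℕ.* 2 ℕ.^ s → ∃[ s ] n ≡ 2 ℕ.^ s
    conclude (s , j , refl) = s , trans (cong (λ j → suc (j ℕ.+ j) ℕ.* 2 ℕ.^ s) j≡0)
      (ℕ.*-identityˡ (2 ℕ.^ s))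
      where
      j≡0 : j ≡ 0
      j≡0 = odd∣Z^ j b (∤-cancelˡ irrY a (∤1+^ irrY (suc (j ℕ.+ j)) (s≤s z≤n))
        (∣-trans (1+p^∣1+p^* Y (suc (j ℕ.+ j)) (2 ℕ.^ s)) 1+Yⁿ∣))

  module _ {P : 𝔽₂[x]} (irrP : Irreducible P) (Y≢P : Y ≢ P) (Z≢P : Z ≢ P) where

    private
      Y∤P = distinct-irreducibles irrY irrP Y≢P
      Z∤P = distinct-irreducibles irrZ irrP Z≢P
      Y∣1+P : Y ∣ 1# + P
      Y∣1+P = Y∣1+ Y∤P
      Z∣1+P : Z ∣ 1# + P
      Z∣1+P = Z∣1+ Z∤P

    -- The divisor is prime to Y, so it has the form Z^i P^l, where i and l are at most 1 by
    -- squarefreeness. Moreover i is 1, since Z = 1 + Y divides 1 + Y^u.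
    odd∣Y^*Z^*P^ : ∀ j a b c → 1# + Y ^ suc (j ℕ.+ j) ∣ Y ^ a * (Z ^ b * P ^ c) →
                   j ≡ 0 ⊎ 1# + Y ^ suc (j ℕ.+ j) ≡ Z * P
    odd∣Y^*Z^*P^ j a b c 1+Yᵘ∣
      with divisor-of-^* irrZ b (∤-cancelˡ irrY a (∤1+^ irrY (suc (j ℕ.+ j)) (s≤s z≤n)) 1+Yᵘ∣)
    ... | i , e , eq , e∣ with ∣^⇒≡^ irrP c e∣
    ...   | l , refl with squarefree-exponent irrZ j i (sym eq)
                        | squarefree-exponent irrP j l (trans (*-comm (P ^ l) (Z ^ i)) (sym eq))
    ...     | inj₁ refl | _ = contradiction (subst (Z ∣_) eq (Z∣1+Y^ (suc (j ℕ.+ j)))) (∤-^ irrZ l Z∤P)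
    ...     | inj₂ refl | inj₁ refl = inj₁
      (1+Y^≡Z⇒ j (trans eq (solve 1 (λ Z → Z :* con true :* con true := Z) refl Z)))
    ...     | inj₂ refl | inj₂ refl = inj₂
      (trans eq (solve 2 (λ Z P → Z :* con true :* (P :* con true) := Z :* P) refl Z P))

    -- The cofactor T of `odd-cofactor` is 1 modulo P (1 + P), and Y and Z divide 1 + P. So T is
    -- prime to Y, Z and P while dividing a product of their powers, which leaves T = 1.
    1+P^odd∣ : ∀ j a b c → 1# + P ^ suc (j ℕ.+ j) ∣ Y ^ a * (Z ^ b * P ^ c) →
               j ≡ 0 × (∃[ e ] ∃[ f ] 1# + P ≡ Y ^ e * Z ^ f)
    1+P^odd∣ j a b c 1+Pʷ∣ = conclude (odd-cofactor P j)
      where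
      conclude : ∃[ T ] 1# + P ^ suc (j ℕ.+ j) ≡ (1# + P) * T × P * (1# + P) ∣ 1# + T →
                 j ≡ 0 × (∃[ e ] ∃[ f ] 1# + P ≡ Y ^ e * Z ^ f)
      conclude (T , eq , P*[1+P]∣1+T) =
        odd-power-exponent irrP j (1+-injective
          (trans eq (trans (cong ((1# + P) *_) T≡1) (*-comm (1# + P) 1#)))) ,
        factor-Y (divisor-of-^* irrY a (∣-trans (∣-*ʳ T ∣-refl) [1+P]T∣))
        where
        [1+P]T∣ : (1# + P) * T ∣ Y ^ a * (Z ^ b * P ^ c)
        [1+P]T∣ = subst (_∣ Y ^ a * (Z ^ b * P ^ c)) eq 1+Pʷ∣
        ∤T : ∀ {Q} → Irreducible Q → Q ∣ P * (1# + P) → Q ∤ T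
        ∤T irrQ Q∣ Q∣T = Irreducible.p∤1 irrQ (∣-+⁻ˡ (∣-trans Q∣ P*[1+P]∣1+T) Q∣T)
        T≡1 : T ≡ 1#
        T≡1 = ∣1⇒≡1 (∤-cancelˡ irrP c (∤T irrP (∣-*ʳ (1# + P) ∣-refl)) (subst (T ∣_) (*-comm 1# (P ^ c))
          (∤-cancelˡ irrZ b (∤T irrZ (∣-*ˡ P Z∣1+P))
            (∤-cancelˡ irrY a (∤T irrY (∣-*ˡ P Y∣1+P)) (∣-trans (∣-*ˡ (1# + P) ∣-refl) [1+P]T∣)))))
        factor-Z : ∀ e r → 1# + P ≡ Y ^ e * r → ∃[ f ] ∃[ s ] r ≡ Z ^ f * s × s ∣ P ^ c →
                   ∃[ e ] ∃[ f ] 1# + P ≡ Y ^ e * Z ^ f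
        factor-Z e _ 1+P≡ (f , s , refl , s∣P^) =
          e , f , trans 1+P≡ (cong (Y ^ e *_) (trans (cong (Z ^ f *_) s≡1) (*-comm (Z ^ f) 1#)))
          where
          -- P does not divide 1 + P, so the part of 1 + P that comes from `P ^ c` is trivial.
          s≡1 : s ≡ 1#
          s≡1 = ∣1⇒≡1 (∤-cancelˡ irrP c
            (λ P∣s → ∤1+ irrP ∣-refl (subst (P ∣_) (sym 1+P≡) (∣-*ˡ (Y ^ e) (∣-*ˡ (Z ^ f) P∣s))))
            (subst (s ∣_) (*-comm 1# (P ^ c)) s∣P^))
        factor-Y : ∃[ e ] ∃[ r ] 1# + P ≡ Y ^ e * r × r ∣ Z ^ b * P ^ c →
                   ∃[ e ] ∃[ f ] 1# + P ≡ Y ^ e * Z ^ f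
        factor-Y (e , r , 1+P≡ , r∣) = factor-Z e r 1+P≡ (divisor-of-^* irrZ b r∣)

    -- Over 𝔽₂, Z * P = 1 + Y^(2j+1) turns into Z * (1 + P) = Y * (1 + Y^(2j)).
    base-shape : ∀ j e f → j ≢ 0 → 1# + Y ^ suc (j ℕ.+ j) ≡ Z * P → 1# + P ≡ Y ^ e * Z ^ f →
                 ∃[ s ] j ℕ.+ j ≡ 2 ℕ.^ s × suc f ≡ 2 ℕ.^ s × 1# + P ≡ Y * Z ^ f
    base-shape j e f j≢0 1+Yᵘ≡ZP 1+P≡ = conclude
      -- By the valuations below, 1 + Y^(2j) is Z^(f+1); the power of Y in the criterion is
      -- therefore taken with exponent 0.
      (∣Y^*Z^⇒2^ (j ℕ.+ j) 0<2j 0 (suc f) (subst (_∣ Z ^ suc f) Z^≡ ∣-refl))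
      where
      open ≡-Reasoning
      0<2j : 0 < j ℕ.+ j
      0<2j = ℕ.≤-trans (ℕ.n≢0⇒n>0 j≢0) (ℕ.m≤m+n j j)
      valuations : e ≡ 1 × Z ^ suc f ≡ 1# + Y ^ (j ℕ.+ j)
      valuations = valuation-unique irrY e 1 (∤-^ irrY (suc f) Y∤Z) (∤1+^ irrY (j ℕ.+ j) 0<2j) (begin
        Y ^ e * (Z * Z ^ f)                         ≡⟨ swap-factors (Y ^ e) Z (Z ^ f) ⟩
        Z * (Y ^ e * Z ^ f)                         ≡⟨ cong (Z *_) 1+P≡ ⟨
        Z * (1# + P)                                ≡⟨ *-distribˡ-+ Z 1# P ⟩
        Z * 1# + Z * P                              ≡⟨ cong (Z * 1# +_) 1+Yᵘ≡ZP ⟨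
        Z * 1# + (1# + Y * Y ^ (j ℕ.+ j))
          ≡⟨ cong (λ W → W * 1# + (1# + Y * Y ^ (j ℕ.+ j))) 1+Y≡Z ⟨
        (1# + Y) * 1# + (1# + Y * Y ^ (j ℕ.+ j))
          ≡⟨ solve 2 (λ Y R → (con true :+ Y) :* con true :+ (con true :+ Y :* R)
                                                         := Y :* con true :* (con true :+ R)) refl Y
                                                           (Y ^ (j ℕ.+ j)) ⟩
        Y ^ 1 * (1# + Y ^ (j ℕ.+ j))                ∎)
      Z^≡ : Z ^ suc f ≡ 1# + Y ^ (j ℕ.+ j)
      Z^≡ = proj₂ valuations
      conclude : ∃[ s ] j ℕ.+ j ≡ 2 ℕ.^ s →
        ∃[ s ] j ℕ.+ j ≡ 2 ℕ.^ s × suc f ≡ 2 ℕ.^ s × 1# + P ≡ Y * Z ^ f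
      conclude (s , 2j≡2^s) = s , 2j≡2^s ,
        ^-injective irrZ (suc f) (2 ℕ.^ s)
          (trans Z^≡ (trans (cong (λ n → 1# + Y ^ n) 2j≡2^s) (1+Y^2^ s))) ,
        trans 1+P≡ (cong (_* Z ^ f) (trans (cong (Y ^_) (proj₁ valuations)) (*-comm Y 1#)))

-- Reducibility of (1 + X^(2^s + 1)) / (1 + X) for s ≥ 3

deg-∷ₚ : ∀ a p → deg (a ∷ₚ p) ≤ suc (deg p)
deg-∷ₚ false 0#     = z≤n
deg-∷ₚ true  0#     = z≤n
deg-∷ₚ a     (nz p) = ℕ.≤-refl

deg-X^* : ∀ n p → deg (X ^ n * p) ≤ n ℕ.+ deg p
deg-X^* zero    p = ℕ.≤-refl
deg-X^* (suc n) p = ℕ.≤-trans (ℕ.≤-reflexive (cong deg (*-assoc X (X ^ n) p)))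
  (ℕ.≤-trans (deg-∷ₚ false (X ^ n * p)) (s≤s (deg-X^* n p)))

deg-+ : ∀ p q {n} → deg p ≤ n → deg q ≤ n → deg (p + q) ≤ n
deg-+ p q {n} p≤n q≤n with deg (p + q) ℕ.≤? n
... | yes p+q≤n = p+q≤n
... | no  p+q≰n = contradiction (begin
  true
    ≡⟨ leading (p + q) (λ 0≡ → p+q≰n (subst (λ r → deg r ≤ n) (sym 0≡) z≤n)) ⟨
  coeff (p + q) m                                       ≡⟨ coeff-+ p q m ⟩
  coeff p m xor coeff q m
    ≡⟨ cong₂ _xor_ (coeff-deg< p (ℕ.≤-<-trans p≤n n<m)) (coeff-deg< q (ℕ.≤-<-trans q≤n n<m)) ⟩
  false                                                 ∎) λ ()
  where
  open ≡-Reasoning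
  m = deg (p + q)
  n<m = ℕ.≰⇒> p+q≰n
  leading : ∀ r → r ≢ 0# → coeff r (deg r) ≡ true
  leading r = ≢0⇒monic {r}

X^-monomial : ∀ n → ∃[ p ] X ^ n ≡ nz p × degNZ p ≡ n
X^-monomial zero = one , refl , refl
X^-monomial (suc n) with X^-monomial n
... | p , eq , deg≡ = false ∷ p , cong (X *_) eq , cong suc deg≡

-- H s is the sum of X^(2^i) and X * L s the sum of X^(2^s + 1 - 2^i), for i < s.
-- Modulo 1 + X^(2^s + 1) the latter exponents are 2^(s+i), so that R s = H s + X * L s
-- becomes the sum of X^(2^i) for i < 2 s, which is fixed by squaring.
H L : ℕ → 𝔽₂[x]
H zero    = 0#
H (suc s) = H s + X ^ (2 ℕ.^ s)
L zero    = 0#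
L (suc s) = X ^ (2 ℕ.^ s) * (L s + 1#)

-- Squaring sends each summand to the next one, so the sum loses X and gains X^(2^s).
H-square : ∀ s → H s * H s ≡ H s + X + X ^ (2 ℕ.^ s)
H-square zero = refl
H-square (suc s) = begin
  (H s + Q) * (H s + Q)
    ≡⟨ solve 2 (λ h q → (h :+ q) :* (h :+ q) := h :* h :+ q :* q) refl (H s) Q ⟩
  H s * H s + Q * Q                  ≡⟨ cong₂ _+_ (H-square s) (sym (^-2^suc X s)) ⟩
  H s + X + Q + X ^ (2 ℕ.^ suc s)
    ≡⟨ solve 4 (λ h x q r → h :+ x :+ q :+ r := h :+ q :+ x :+ r) refl (H s) X Q (X ^ (2 ℕ.^ suc s)) ⟩
  H s + Q + X + X ^ (2 ℕ.^ suc s)    ∎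
  where
  open ≡-Reasoning
  Q = X ^ (2 ℕ.^ s)

-- Stated with an extra factor X, as X^(2^(s+1) − 1) would need a subtraction.
L-square : ∀ s → X * (L s * L s) ≡ X * (X ^ (2 ℕ.^ s) * (L s + 1#)) + X ^ (2 ℕ.^ s) * X ^ (2 ℕ.^ s)
L-square zero = refl
L-square (suc s) = begin
  X * (Q * (l + 1#) * (Q * (l + 1#)))
    ≡⟨ solve 3 (λ x q l → x :* (q :* (l :+ con true) :* (q :* (l :+ con true)))
         := q :* q :* (x :* (l :* l)) :+ x :* (q :* q)) refl X Q l ⟩
  Q * Q * (X * (l * l)) + X * (Q * Q)
    ≡⟨ cong (λ r → Q * Q * r + X * (Q * Q)) (L-square s) ⟩
  Q * Q * (X * (Q * (l + 1#)) + Q * Q) + X * (Q * Q)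
    ≡⟨ solve 3 (λ x q l → q :* q :* (x :* (q :* (l :+ con true)) :+ q :* q) :+ x :* (q :* q)
               := x :* (q :* q :* (q :* (l :+ con true) :+ con true)) :+ (q :* q) :* (q :* q)) refl X Q
                 l ⟩
  X * (Q * Q * (L (suc s) + 1#)) + Q * Q * (Q * Q)
    ≡⟨ cong (λ r → X * (r * (L (suc s) + 1#)) + r * r) (^-2^suc X s) ⟨
  X * (X ^ (2 ℕ.^ suc s) * (L (suc s) + 1#)) + X ^ (2 ℕ.^ suc s) * X ^ (2 ℕ.^ suc s) ∎
  where
  open ≡-Reasoning
  Q = X ^ (2 ℕ.^ s)
  l = L s

R : ℕ → 𝔽₂[x]
R s = H s + X * L s

-- Consequently an irreducible divisor of the modulus divides `R s` or `1# + R s`. The witness is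
-- the exact quotient of R + R² by 1 + X^(q+1), where q = 2^s.
R-idempotent : ∀ s → 1# + X ^ suc (2 ℕ.^ s) ∣ R s * (1# + R s)
R-idempotent s = X + Q + X * L s , sym (begin
  (H s + X * L s) * (1# + (H s + X * L s))
    ≡⟨ solve 3 (λ h x l → (h :+ x :* l) :* (con true :+ (h :+ x :* l))
         := h :+ x :* l :+ h :* h :+ x :* (x :* (l :* l))) refl (H s) X (L s) ⟩
  H s + X * L s + H s * H s + X * (X * (L s * L s))
    ≡⟨ cong₂ (λ u v → H s + X * L s + u + X * v) (H-square s) (L-square s) ⟩
  H s + X * L s + (H s + X + Q) + X * (X * (Q * (L s + 1#)) + Q * Q)
    ≡⟨ solve 4 (λ h x l q → h :+ x :* l :+ (h :+ x :+ q) :+ x :* (x :* (q :* (l :+ con true)) :+ q :* q)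
               := (x :+ q :+ x :* l) :* (con true :+ x :* q)) refl (H s) X (L s) Q ⟩
  (X + Q + X * L s) * (1# + X * Q) ∎)
  where
  open ≡-Reasoning
  Q = X ^ (2 ℕ.^ s)

2^s≤2^suc : ∀ s → 2 ℕ.^ s ≤ 2 ℕ.^ suc s
2^s≤2^suc s = ℕ.m≤m+n _ _

deg-X^ : ∀ n → deg (X ^ n) ≤ n
deg-X^ n with X^-monomial n
... | p , eq , deg≡ = ℕ.≤-reflexive (trans (cong deg eq) deg≡)

deg-H : ∀ s → deg (H s) ≤ 2 ℕ.^ s
deg-H zero    = z≤n
deg-H (suc s) = deg-+ (H s) _ (ℕ.≤-trans (deg-H s) (2^s≤2^suc s))
  (ℕ.≤-trans (deg-X^ (2 ℕ.^ s)) (2^s≤2^suc s))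

-- The extra factor X makes the bound recursive: X L(s+1) = X^(2^s) (X L(s) + X).
deg-XL : ∀ s → deg (X * L s) ≤ 2 ℕ.^ s
deg-XL zero    = z≤n
deg-XL (suc s) = ℕ.≤-trans (ℕ.≤-reflexive (cong deg (solve 3 (λ x q l → x :* (q :* (l :+ con true))
  := q :* (x :* l :+ x)) refl X Q (L s))))
  (ℕ.≤-trans (deg-X^* (2 ℕ.^ s) (X * L s + X))
    (ℕ.≤-trans (ℕ.+-monoʳ-≤ (2 ℕ.^ s) (deg-+ (X * L s) X (deg-XL s) (2^n>0 s)))
      (ℕ.≤-reflexive (cong (2 ℕ.^ s ℕ.+_) (sym (ℕ.+-identityʳ _))))))
  where Q = X ^ (2 ℕ.^ s)

deg-R : ∀ s → deg (R s) ≤ 2 ℕ.^ s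
deg-R s = deg-+ (H s) (X * L s) (deg-H s) (deg-XL s)

X^4∣X^2^ : ∀ s → X ^ 4 ∣ X ^ (2 ℕ.^ (2 ℕ.+ s))
X^4∣X^2^ zero    = ∣-refl
X^4∣X^2^ (suc s) = subst (X ^ 4 ∣_) (sym (^-2^suc X (2 ℕ.+ s))) (∣-*ʳ _ (X^4∣X^2^ s))

H-low : ∀ s → X ^ 4 ∣ H (2 ℕ.+ s) + (X + X ^ 2)
H-low zero    = 0# , refl
H-low (suc s) = subst (X ^ 4 ∣_) (solve 3 (λ h q r → h :+ r :+ q
  := h :+ q :+ r) refl (H (2 ℕ.+ s)) Q (X + X ^ 2))
  (∣-+ (H-low s) (X^4∣X^2^ s))
  where Q = X ^ (2 ℕ.^ (2 ℕ.+ s))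

-- From index 3 on, `L` has a factor X^(2^i) with i at least 2, so only the X and X² of `H` survive
-- modulo X⁴. At index 2 the term X³ is still present, which is how the case q = 4 escapes.
R-low : ∀ s → X ^ 4 ∣ R (3 ℕ.+ s) + (X + X ^ 2)
R-low s = subst (X ^ 4 ∣_) (solve 3 (λ h l r → h :+ r :+ l
  := h :+ l :+ r) refl (H (3 ℕ.+ s)) (X * L (3 ℕ.+ s)) (X + X ^ 2))
  (∣-+ (H-low (suc s)) (∣-*ˡ X (∣-*ʳ (L (2 ℕ.+ s) + 1#) (X^4∣X^2^ s))))

coeff-X^* : ∀ n p {i} → i < n → coeff (X ^ n * p) i ≡ false
coeff-X^* (suc n) p {i} i<n = trans (cong (λ q → coeff q i) (*-assoc X (X ^ n) p)) (go i i<n)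
  where
  go : ∀ i → i < suc n → coeff (X * (X ^ n * p)) i ≡ false
  go zero    _         = coeff-∷ₚ-zero false (X ^ n * p)
  go (suc i) (s≤s i<n) = trans (coeff-∷ₚ-suc false (X ^ n * p) i) (coeff-X^* n p i<n)

-- P divides ε + R with ε = 0 or 1, and the degrees make the quotient a constant b. Multiplying by X
-- + 1 and reducing modulo X⁴ yields (X + 1)(ε + X + X²) = b, whose two sides differ in the
-- coefficient of X³.
no-large-base : ∀ s {P} → Irreducible P → (X + 1#) * P ≢ 1# + X ^ suc (2 ℕ.^ (3 ℕ.+ s))
no-large-base s {P} irrP [X+1]P≡ = case
  (∣*⇒∣⊎∣ irrP (∣-trans (X + 1# , [X+1]P≡) (R-idempotent (3 ℕ.+ s))))
  where
  open ≡-Reasoning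
  N = 2 ℕ.^ (3 ℕ.+ s)
  r = R (3 ℕ.+ s)
  -- Degrees are compared after multiplication by X + 1, because (X + 1) P is known explicitly and
  -- has degree N + 1.
  constant : ∀ g → deg ((X + 1#) * P * g) ≤ suc N → ∃[ b ] g ≡ b · 1#
  constant 0# _ = false , refl
  constant (nz one) _ = true , refl
  constant (nz (b ∷ g)) deg≤ with X^-monomial N
  ... | p , eq , deg≡ = contradiction
    (ℕ.≤-trans (deg-* (true ∷ p) (b ∷ g))
      (ℕ.≤-trans (ℕ.≤-reflexive (cong (λ q → deg (q * nz (b ∷ g)))
      (sym (trans [X+1]P≡ (cong (λ q → 1# + X * q) eq))))) deg≤))
    (subst (λ n → suc (n ℕ.+ suc (degNZ g)) ℕ.≰ suc N) (sym deg≡) (ℕ.m+1+n≰m (suc N)))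
  impossible : ∀ ε → ¬ (P ∣ ε · 1# + r)
  impossible ε (g , gP≡) = from-constant (constant g (subst (λ q → deg q ≤ suc N) (begin
      X * (ε · 1# + r) + (ε · 1# + r)    ≡⟨ cong (λ q → X * q + q) gP≡ ⟨
      X * (g * P) + g * P
        ≡⟨ solve 3 (λ x g p → x :* (g :* p) :+ g :* p := (x :+ con true) :* p :* g) refl X g P ⟩
      (X + 1#) * P * g                   ∎)
      (deg-+ (X * (ε · 1# + r)) (ε · 1# + r) (ℕ.≤-trans (deg-∷ₚ false (ε · 1# + r)) (s≤s deg≤))
        (ℕ.≤-trans deg≤ (ℕ.n≤1+n N)))))
    where
    deg-const : ∀ ε → deg (ε · 1#) ≤ N
    deg-const false = z≤n
    deg-const true  = z≤n
    deg≤ : deg (ε · 1# + r) ≤ N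
    deg≤ = deg-+ (ε · 1#) r (deg-const ε) (deg-R (3 ℕ.+ s))
    from-constant : ∃[ b ] g ≡ b · 1# → ⊥
    from-constant (b , refl) = modulo-X⁴ (R-low s) (X^4∣X^2^ (suc s))
      where
      modulo-X⁴ : X ^ 4 ∣ r + (X + X ^ 2) → X ^ 4 ∣ X ^ N → ⊥
      modulo-X⁴ (u , uX⁴≡) (v , vX⁴≡) = compare ε b
        (trans (cong (λ q → coeff q 3) combined) (coeff-X^* 4 t (s≤s (s≤s (s≤s (s≤s z≤n))))))
        where
        e = ε · 1#
        c = b · 1#
        xs = X + X ^ 2
        t = (X + 1#) * u + c * (X * v)
        -- (X + 1)(ε + X + X²) ≡ b modulo X⁴
        combined : (X + 1#) * (ε · 1# + (X + X ^ 2)) + b · 1# ≡ X ^ 4 * t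
        combined = begin
          (X + 1#) * (e + xs) + c
            ≡⟨ solve 5 (λ x e xs r c → (x :+ con true) :* (e :+ xs) :+ c
                 := (x :+ con true) :* (e :+ r) :+ (x :+ con true) :* (r :+ xs) :+ c) refl X e xs r c ⟩
          (X + 1#) * (e + r) + (X + 1#) * (r + xs) + c
            ≡⟨ cong₂ (λ q q′ → (X + 1#) * q + (X + 1#) * q′ + c) gP≡ uX⁴≡ ⟨
          (X + 1#) * (c * P) + (X + 1#) * (u * X ^ 4) + c
            ≡⟨ solve 5 (λ x c p u m → (x :+ con true) :* (c :* p) :+ (x :+ con true) :*
                 (u :* m) :+ c := c :* ((x :+ con true) :* p) :+ (x :+ con true) :* (u :* m) :+ c) refl
                 X c P u (X ^ 4) ⟩
          c * ((X + 1#) * P) + (X + 1#) * (u * X ^ 4) + c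
            ≡⟨ cong (λ q → c * q + (X + 1#) * (u * X ^ 4) + c)
                 (trans [X+1]P≡ (cong (λ q → 1# + X * q) (sym vX⁴≡))) ⟩
          c * (1# + X * (v * X ^ 4)) + (X + 1#) * (u * X ^ 4) + c
            ≡⟨ solve 5 (λ x c u v m → c :* (con true :+ x :* (v :* m)) :+ (x :+ con true) :*
                 (u :* m) :+ c := m :* ((x :+ con true) :* u :+ c :* (x :* v))) refl X c u v (X ^ 4) ⟩
          X ^ 4 * t ∎
        -- The coefficient of X³ on the left is 1 for all four choices of ε and b.
        compare : ∀ ε b → coeff ((X + 1#) * (ε · 1# + (X + X ^ 2)) + b · 1#) 3 ≡ false → ⊥
        compare false false ()
        compare false true  ()
        compare true  false ()
        compare true  true  ()

  case : P ∣ r ⊎ P ∣ 1# + r → ⊥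
  case (inj₁ P∣r)   = impossible false P∣r
  case (inj₂ P∣1+r) = impossible true P∣1+r

-- The listed polynomials are unitary perfect

-- Substituting X + 1 is a ring automorphism of order two, so a factorisation of the image can be
-- pulled back.
irreducible-∘[X+1] : ∀ {P} → Irreducible P → Irreducible (P ∘ (X + 1#))
irreducible-∘[X+1] {P} irr = mkIrred
  (λ P∘∣1 → irreducible-≢1 irr (trans (sym (∘[X+1]-involutive P)) (cong (_∘ (X + 1#)) (∣1⇒≡1 P∘∣1))))
  λ {f} {g} eq → split {f} {g} (Irreducible.split-∣1 irr (trans (sym (∘[X+1]-involutive P))
    (trans (cong (_∘ (X + 1#)) eq) (∘-* (X + 1#) f g))))
  where
  back : ∀ f → f ∘ (X + 1#) ∣ 1# → f ∣ 1#
  back f f∘∣1 = subst (_∣ 1#) (trans (cong (_∘ (X + 1#)) (sym (∣1⇒≡1 f∘∣1)))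
    (∘[X+1]-involutive f)) ∣-refl
  split : ∀ {f g} → f ∘ (X + 1#) ∣ 1# ⊎ g ∘ (X + 1#) ∣ 1# → f ∣ 1# ⊎ g ∣ 1#
  split {f} (inj₁ f∘∣1) = inj₁ (back f f∘∣1)
  split {g = g} (inj₂ g∘∣1) = inj₂ (back g g∘∣1)

σ*-two : ∀ {Y Z} → Irreducible Y → Irreducible Z → Y ≢ Z → ∀ a b → 0 < a → 0 < b →
         σ* (Y ^ a * Z ^ b) ≡ (1# + Y ^ a) * (1# + Z ^ b)
σ*-two {Y} {Z} irrY irrZ Y≢Z a b 0<a 0<b = begin
  σ* (Y ^ a * Z ^ b)
    ≡⟨ σ*-^* irrY (∤-^ irrY b (distinct-irreducibles irrY irrZ Y≢Z))
         (^-≢0 b (irreducible-≢0 irrZ)) a 0<a ⟩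
  (1# + Y ^ a) * σ* (Z ^ b)                    ≡⟨ cong (λ q → (1# + Y ^ a) * σ* q) (*-comm 1# (Z ^ b)) ⟩
  -- Multiplicativity is applied with cofactor 1, and `σ* 1#` evaluates to `1#`.
  (1# + Y ^ a) * σ* (Z ^ b * 1#)
    ≡⟨ cong ((1# + Y ^ a) *_) (σ*-^* irrZ (Irreducible.p∤1 irrZ) (λ ()) b 0<b) ⟩
  (1# + Y ^ a) * ((1# + Z ^ b) * 1#)           ≡⟨ cong ((1# + Y ^ a) *_) (*-comm (1# + Z ^ b) 1#) ⟩
  (1# + Y ^ a) * (1# + Z ^ b)                  ∎
  where open ≡-Reasoning

σ*-three : ∀ {Y Z P} → Irreducible Y → Irreducible Z → Irreducible P → Y ≢ Z → Y ≢ P → Z ≢ P →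
           ∀ a b c → 0 < a → 0 < b → 0 < c →
           σ* (Y ^ a * (Z ^ b * P ^ c)) ≡ (1# + Y ^ a) * ((1# + Z ^ b) * (1# + P ^ c))
σ*-three irrY irrZ irrP Y≢Z Y≢P Z≢P a b c 0<a 0<b 0<c = trans
  (σ*-^* irrY (∤-* irrY (∤-^ irrY b (distinct-irreducibles irrY irrZ Y≢Z))
    (∤-^ irrY c (distinct-irreducibles irrY irrP Y≢P)))
    (*-≢0 (^-≢0 b (irreducible-≢0 irrZ)) (^-≢0 c (irreducible-≢0 irrP))) a 0<a)
  (cong ((1# + _ ^ a) *_) (σ*-two irrZ irrP Z≢P b c 0<b 0<c))

^-distrib-*₃ : ∀ p q r n → (p * (q * r)) ^ n ≡ p ^ n * (q ^ n * r ^ n)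
^-distrib-*₃ p q r n = trans (^-distrib-* p (q * r) n) (cong (p ^ n *_) (^-distrib-* q r n))

^-^-distrib-*₃ : ∀ p q r a b c n →
  (p ^ a * (q ^ b * r ^ c)) ^ n ≡ p ^ (a ℕ.* n) * (q ^ (b ℕ.* n) * r ^ (c ℕ.* n))
^-^-distrib-*₃ p q r a b c n = trans (^-distrib-*₃ (p ^ a) (q ^ b) (r ^ c) n)
  (cong₂ _*_ (^-assocʳ p a n) (cong₂ _*_ (^-assocʳ q b n) (^-assocʳ r c n)))

-- Raising the equation for the exponents a and b to the power 2^n gives, by Frobenius, the equation
-- for a 2^n and b 2^n. So only n = 0 needs a computation.
unitaryPerfect-two-^2^ : ∀ {Y Z} → Irreducible Y → Irreducible Z → Y ≢ Z →
  ∀ a b → 0 < a → 0 < b → (1# + Y ^ a) * (1# + Z ^ b) ≡ Y ^ a * Z ^ b →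
  ∀ n → UnitaryPerfect ((Y ^ a * Z ^ b) ^ (2 ℕ.^ n))
unitaryPerfect-two-^2^ {Y} {Z} irrY irrZ Y≢Z a b 0<a 0<b eq n = begin
  σ* ((Y ^ a * Z ^ b) ^ N)
    ≡⟨ cong σ* (trans (^-distrib-* (Y ^ a) (Z ^ b) N) (cong₂ _*_ (^-assocʳ Y a N) (^-assocʳ Z b N))) ⟩
  σ* (Y ^ (a ℕ.* N) * Z ^ (b ℕ.* N))
    ≡⟨ σ*-two irrY irrZ Y≢Z _ _ (ℕ.*-mono-< 0<a (2^n>0 n)) (ℕ.*-mono-< 0<b (2^n>0 n)) ⟩
  (1# + Y ^ (a ℕ.* N)) * (1# + Z ^ (b ℕ.* N))      ≡⟨ cong₂ _*_ (1+^-* a n Y) (1+^-* b n Z) ⟩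
  (1# + Y ^ a) ^ N * (1# + Z ^ b) ^ N              ≡⟨ ^-distrib-* (1# + Y ^ a) (1# + Z ^ b) N ⟨
  ((1# + Y ^ a) * (1# + Z ^ b)) ^ N                ≡⟨ cong (_^ N) eq ⟩
  (Y ^ a * Z ^ b) ^ N                              ∎
  where
  open ≡-Reasoning
  N = 2 ℕ.^ n

unitaryPerfect-three-^2^ : ∀ {Y Z P} → Irreducible Y → Irreducible Z → Irreducible P → Y ≢ Z → Y ≢ P →
  Z ≢ P →
  ∀ a b c → 0 < a → 0 < b → 0 < c →
  (1# + Y ^ a) * ((1# + Z ^ b) * (1# + P ^ c)) ≡ Y ^ a * (Z ^ b * P ^ c) →
  ∀ n → UnitaryPerfect ((Y ^ a * (Z ^ b * P ^ c)) ^ (2 ℕ.^ n))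
unitaryPerfect-three-^2^ {Y} {Z} {P} irrY irrZ irrP Y≢Z Y≢P Z≢P a b c 0<a 0<b 0<c eq n = begin
  σ* ((Y ^ a * (Z ^ b * P ^ c)) ^ N)
    ≡⟨ cong σ* (^-^-distrib-*₃ Y Z P a b c N) ⟩
  σ* (Y ^ (a ℕ.* N) * (Z ^ (b ℕ.* N) * P ^ (c ℕ.* N)))
    ≡⟨ σ*-three irrY irrZ irrP Y≢Z Y≢P Z≢P _ _ _ (ℕ.*-mono-< 0<a (2^n>0 n)) (ℕ.*-mono-< 0<b (2^n>0 n))
         (ℕ.*-mono-< 0<c (2^n>0 n)) ⟩
  (1# + Y ^ (a ℕ.* N)) * ((1# + Z ^ (b ℕ.* N)) * (1# + P ^ (c ℕ.* N)))
    ≡⟨ cong₂ _*_ (1+^-* a n Y) (cong₂ _*_ (1+^-* b n Z) (1+^-* c n P)) ⟩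
  (1# + Y ^ a) ^ N * ((1# + Z ^ b) ^ N * (1# + P ^ c) ^ N)
    ≡⟨ ^-distrib-*₃ (1# + Y ^ a) (1# + Z ^ b) (1# + P ^ c) N ⟨
  ((1# + Y ^ a) * ((1# + Z ^ b) * (1# + P ^ c))) ^ N
    ≡⟨ cong (_^ N) eq ⟩
  (Y ^ a * (Z ^ b * P ^ c)) ^ N ∎
  where
  open ≡-Reasoning
  N = 2 ℕ.^ n

x²+x+1 x⁴+x³+x²+x+1 : 𝔽₂[x]
x²+x+1       = X ^ 2 + X + 1#
x⁴+x³+x²+x+1 = X ^ 4 + X ^ 3 + X ^ 2 + X + 1#

irreducible-x²+x+1 : Irreducible x²+x+1
irreducible-x²+x+1 = toWitness {a? = irreducible? x²+x+1} _

irreducible-x⁴+x³+x²+x+1 : Irreducible x⁴+x³+x²+x+1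
irreducible-x⁴+x³+x²+x+1 = toWitness {a? = irreducible? x⁴+x³+x²+x+1} _

irreducible-X : Irreducible X
irreducible-X = irreducible-linear false

irreducible-X+1 : Irreducible (X + 1#)
irreducible-X+1 = irreducible-linear true

-- The base equations are identities between explicit polynomials and hold by evaluation. The
-- substitution fixes x² + x + 1 but not x⁴ + x³ + x² + x + 1, whose irreducibility is transported.
listed-unitaryPerfect : ∀ {B} → Listed B → ∀ n →
  UnitaryPerfect (B ^ (2 ℕ.^ n)) × UnitaryPerfect ((B ∘ (X + 1#)) ^ (2 ℕ.^ n))
listed-unitaryPerfect case-i n =
  unitaryPerfect-two-^2^ irreducible-X irreducible-X+1 (λ ()) 1 1 (s≤s z≤n) (s≤s z≤n) refl n ,
  unitaryPerfect-two-^2^ irreducible-X irreducible-X+1 (λ ()) 1 1 (s≤s z≤n) (s≤s z≤n) refl n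
listed-unitaryPerfect case-ii₁ n =
  unitaryPerfect-three-^2^ irreducible-X irreducible-X+1 irreducible-x²+x+1 (λ ()) (λ ()) (λ ())
    3 2 1 (s≤s z≤n) (s≤s z≤n) (s≤s z≤n) refl n ,
  unitaryPerfect-three-^2^ irreducible-X+1 irreducible-X irreducible-x²+x+1 (λ ()) (λ ()) (λ ())
    3 2 1 (s≤s z≤n) (s≤s z≤n) (s≤s z≤n) refl n
listed-unitaryPerfect case-ii₂ n =
  unitaryPerfect-three-^2^ irreducible-X irreducible-X+1 irreducible-x⁴+x³+x²+x+1 (λ ()) (λ ()) (λ ())
    5 4 1 (s≤s z≤n) (s≤s z≤n) (s≤s z≤n) refl n ,
  unitaryPerfect-three-^2^ irreducible-X+1 irreducible-X (irreducible-∘[X+1] irreducible-x⁴+x³+x²+x+1)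
    (λ ()) (λ ()) (λ ())
    5 4 1 (s≤s z≤n) (s≤s z≤n) (s≤s z≤n) refl n
listed-unitaryPerfect case-iii n =
  unitaryPerfect-three-^2^ irreducible-X irreducible-X+1 irreducible-x²+x+1 (λ ()) (λ ()) (λ ())
    3 3 2 (s≤s z≤n) (s≤s z≤n) (s≤s z≤n) refl n ,
  unitaryPerfect-three-^2^ irreducible-X+1 irreducible-X irreducible-x²+x+1 (λ ()) (λ ()) (λ ())
    3 3 2 (s≤s z≤n) (s≤s z≤n) (s≤s z≤n) refl n

listedPower⇒unitaryPerfect : ∀ A → ListedPower A ⊎ ListedPower (A ∘ (X + 1#)) → UnitaryPerfect A
listedPower⇒unitaryPerfect A (inj₁ (B , n , listed , refl)) = proj₁ (listed-unitaryPerfect listed n)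
listedPower⇒unitaryPerfect A (inj₂ (B , n , listed , A∘≡)) = subst UnitaryPerfect
  (trans (sym (∘-^ (X + 1#) B (2 ℕ.^ n))) (trans (cong (_∘ (X + 1#)) (sym A∘≡)) (∘[X+1]-involutive A)))
  (proj₂ (listed-unitaryPerfect listed n))

-- Classification

module _ {Y Z : 𝔽₂[x]} (pair : ComplementaryPair Y Z) where

  open ComplementaryPair pair

  -- Modulo Y every polynomial not divisible by Y is 1. This applies to P^k, so Y divides the factor
  -- 1 + P^k of the left-hand `σ*`.
  ∤⇒∣σ* : ∀ {P} A k → Irreducible P → P ∤ A → Y ∤ P → 0 < k → A ≢ 0# → Y ∣ σ* (P ^ k * A)
  ∤⇒∣σ* {P} A k irrP P∤A Y∤P 0<k A≢0 = subst (Y ∣_) (sym (σ*-^* irrP P∤A A≢0 k 0<k))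
    (∣-*ʳ (σ* A) (Y∣1+ (∤-^ irrY k Y∤P)))

  unitaryPerfect⇒∣ : ∀ A → 0 < deg A → UnitaryPerfect A → Y ∣ A
  unitaryPerfect⇒∣ A 0<A σ*A≡A with Y ∣? A
  ... | yes Y∣A = Y∣A
  ... | no  Y∤A with irreducible-divisor (deg A) A ℕ.≤-refl 0<A
  ...   | P , irrP , P∣A with extract-power irrP (deg A) A ℕ.≤-refl
    (λ { refl → contradiction 0<A λ () })
  ...     | zero , N , refl , P∤N = contradiction P∣A P∤N
  ...     | suc k , N , refl , P∤N = subst (Y ∣_) σ*A≡A (∤⇒∣σ* N (suc k) irrP P∤N
    (λ Y∣P → Y∤A (∣-trans Y∣P P∣A))
      (s≤s z≤n) λ { refl → contradiction (subst (λ q → 0 < deg q) (*-zeroʳ (P ^ suc k)) 0<A) λ () })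

  two-factors : ∀ a b → 0 < a → 0 < b → (1# + Y ^ a) * (1# + Z ^ b) ≡ Y ^ a * Z ^ b →
                ∃[ s ] Y ^ a * Z ^ b ≡ (Y * Z) ^ (2 ℕ.^ s)
  two-factors a b 0<a 0<b eq with ∣Y^*Z^⇒2^ pair a 0<a a b
    (1# + Z ^ b , trans (*-comm (1# + Z ^ b) (1# + Y ^ a)) eq)
  ... | s , refl = s , (begin
    Y ^ N * Z ^ b         ≡⟨ cong (λ n → Y ^ N * Z ^ n) b≡N ⟩
    Y ^ N * Z ^ N         ≡⟨ ^-distrib-* Y Z N ⟨
    (Y * Z) ^ N           ∎)
    where
    open ≡-Reasoning
    N = 2 ℕ.^ s
    -- Only the Z-adic valuations matter: Z ∤ 1 + Z^b, and 1 + Y^N = Z^N.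
    b≡N : b ≡ N
    b≡N = proj₁ (valuation-unique irrZ b N (∤-^ irrZ N Z∤Y) (∤1+^ irrZ b 0<b) (begin
      Z ^ b * Y ^ N              ≡⟨ *-comm (Z ^ b) (Y ^ N) ⟩
      Y ^ N * Z ^ b              ≡⟨ eq ⟨
      (1# + Y ^ N) * (1# + Z ^ b)  ≡⟨ cong (_* (1# + Z ^ b)) (1+Y^2^ pair s) ⟩
      Z ^ N * (1# + Z ^ b)       ∎))

  -- Kept as a hypothesis so that the argument runs for both orders of X and X + 1; it is
  -- established for Y = X and carried over to Y = X + 1 by substitution.
  NoLargeBase : Set
  NoLargeBase = ∀ s {P} → Irreducible P → Z * P ≢ 1# + Y ^ suc (2 ℕ.^ (3 ℕ.+ s))

  -- The three factors on the left become (Z P)^N, Y^b and (Y Z^f)^c. Comparing the exponents of P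
  -- and Z gives c = N and b = N + f N = q N.
  one-sided-power : ∀ {P} → Irreducible P → Y ≢ P → Z ≢ P →
    ∀ k l m f q → (let N = 2 ℕ.^ k; a = suc q ℕ.* N; b = 2 ℕ.^ l; c = 2 ℕ.^ m) →
    suc f ≡ q → 1# + Y ^ suc q ≡ Z * P → 1# + P ≡ Y * Z ^ f →
    (1# + Y ^ a) * ((1# + Z ^ b) * (1# + P ^ c)) ≡ Y ^ a * (Z ^ b * P ^ c) →
    Y ^ a * (Z ^ b * P ^ c) ≡ (Y ^ suc q * (Z ^ q * P)) ^ N
  one-sided-power {P} irrP Y≢P Z≢P k l m f q suc[f]≡q 1+Yᵘ≡ZP 1+P≡ eq = begin
    Y ^ a * (Z ^ b * P ^ c)
      ≡⟨ cong₂ (λ u v → Y ^ a * (Z ^ u * P ^ v)) b≡qN c≡N ⟩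
    Y ^ a * (Z ^ (q ℕ.* N) * P ^ N)
      ≡⟨ cong₂ (λ u v → u * (v * P ^ N)) (^-assocʳ Y (suc q) N) (^-assocʳ Z q N) ⟨
    (Y ^ suc q) ^ N * ((Z ^ q) ^ N * P ^ N)
      ≡⟨ ^-distrib-*₃ (Y ^ suc q) (Z ^ q) P N ⟨
    (Y ^ suc q * (Z ^ q * P)) ^ N ∎
    where
    open ≡-Reasoning
    N = 2 ℕ.^ k
    a = suc q ℕ.* N
    b = 2 ℕ.^ l
    c = 2 ℕ.^ m
    exponents : a ≡ b ℕ.+ c × b ≡ N ℕ.+ f ℕ.* c × c ≡ N
    exponents = exponents-unique irrY irrZ irrP Y≢Z Y≢P Z≢P a b c (b ℕ.+ c) (N ℕ.+ f ℕ.* c) N (begin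
      Y ^ a * (Z ^ b * P ^ c)
        ≡⟨ eq ⟨
      (1# + Y ^ a) * ((1# + Z ^ b) * (1# + P ^ c))
        ≡⟨ cong₂ _*_ (trans (1+^-* (suc q) k Y) (trans (cong (_^ N) 1+Yᵘ≡ZP) (^-distrib-* Z P N)))
             (cong₂ _*_ (1+Z^2^ pair l)
               (trans (sym (frobenius-1+ m P)) (trans (cong (_^ c) 1+P≡)
                 (trans (^-distrib-* Y (Z ^ f) c) (cong (Y ^ c *_) (^-assocʳ Z f c)))))) ⟩
      (Z ^ N * P ^ N) * (Y ^ b * (Y ^ c * Z ^ (f ℕ.* c)))
        ≡⟨ solve 5 (λ zn pn yb yc zf → (zn :* pn) :* (yb :* (yc :* zf))
             := (yb :* yc) :* ((zn :* zf) :* pn)) refl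
             (Z ^ N) (P ^ N) (Y ^ b) (Y ^ c) (Z ^ (f ℕ.* c)) ⟩
      (Y ^ b * Y ^ c) * ((Z ^ N * Z ^ (f ℕ.* c)) * P ^ N)
        ≡⟨ cong₂ (λ u v → u * (v * P ^ N)) (^-homo-* Y b c) (^-homo-* Z N (f ℕ.* c)) ⟨
      Y ^ (b ℕ.+ c) * (Z ^ (N ℕ.+ f ℕ.* c) * P ^ N) ∎)
    c≡N : c ≡ N
    c≡N = proj₂ (proj₂ exponents)
    b≡qN : b ≡ q ℕ.* N
    b≡qN = trans (proj₁ (proj₂ exponents))
      (trans (cong (λ c → N ℕ.+ f ℕ.* c) c≡N) (cong (ℕ._* N) suc[f]≡q))

  -- P is the cofactor of 1 + Y in 1 + Y^(q+1), for q = 2 and q = 4.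
  SmallBase : ℕ → 𝔽₂[x] → Set
  SmallBase q P = q ≡ 2 × P ≡ Y ^ 2 + Y + 1# ⊎ q ≡ 4 × P ≡ Y ^ 4 + Y ^ 3 + Y ^ 2 + Y + 1#

  small-base : NoLargeBase → ∀ {P} → Irreducible P → ∀ j s → j ℕ.+ j ≡ 2 ℕ.^ s →
               1# + Y ^ suc (2 ℕ.^ s) ≡ Z * P → SmallBase (2 ℕ.^ s) P
  small-base _ irrP j 0 2j≡1 _ = contradiction 2j≡1 (odd j)
    where
    odd : ∀ j → j ℕ.+ j ≢ 1
    odd (suc j) eq with () ← trans (sym (ℕ.+-suc j j)) (ℕ.suc-injective eq)
  small-base _ irrP j 1 _ eq = inj₁ (refl , *-cancelˡ (irreducible-≢0 irrZ) (trans (sym eq) (trans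
    (solve 1 (λ Y → con true :+ Y :* (Y :* (Y :* con true))
      := (con true :+ Y) :* (Y :* (Y :* con true) :+ Y :+ con true)) refl Y)
    (cong (_* (Y ^ 2 + Y + 1#)) 1+Y≡Z))))
  small-base _ irrP j 2 _ eq = inj₂ (refl , *-cancelˡ (irreducible-≢0 irrZ) (trans (sym eq) (trans
    (solve 1 (λ Y → con true :+ Y :* (Y :* (Y :* (Y :* (Y :* con true))))
      := (con true :+ Y) :* (Y :* (Y :* (Y :* (Y :* con true))) :+ Y :* (Y :* (Y :* con true)) :+ Y :*
        (Y :* con true) :+ Y :+ con true)) refl Y)
    (cong (_* (Y ^ 4 + Y ^ 3 + Y ^ 2 + Y + 1#)) 1+Y≡Z))))
  small-base noLarge irrP j (suc (suc (suc s))) _ eq = contradiction (sym eq) (noLarge s irrP)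

  -- The case in which b is a power of 2: then 1 + Z^b is a power of Y, and P on the left comes from
  -- 1 + Y^a alone.
  one-sided : NoLargeBase → ∀ {P} → Irreducible P → Y ≢ P → Z ≢ P →
    ∀ k j l m e f → j ≢ 0 → (let a = suc (j ℕ.+ j) ℕ.* 2 ℕ.^ k; b = 2 ℕ.^ l; c = 2 ℕ.^ m) →
    1# + Y ^ suc (j ℕ.+ j) ≡ Z * P → 1# + P ≡ Y ^ e * Z ^ f →
    (1# + Y ^ a) * ((1# + Z ^ b) * (1# + P ^ c)) ≡ Y ^ a * (Z ^ b * P ^ c) →
    ∃[ q ] SmallBase q P × Y ^ a * (Z ^ b * P ^ c) ≡ (Y ^ suc q * (Z ^ q * P)) ^ (2 ℕ.^ k)
  one-sided noLarge {P} irrP Y≢P Z≢P k j l m e f j≢0 1+Yᵘ≡ZP 1+P≡′ eq = conclude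
    (base-shape pair irrP Y≢P Z≢P j e f j≢0 1+Yᵘ≡ZP 1+P≡′)
    where
    a = suc (j ℕ.+ j) ℕ.* 2 ℕ.^ k
    b = 2 ℕ.^ l
    c = 2 ℕ.^ m
    conclude : ∃[ s ] j ℕ.+ j ≡ 2 ℕ.^ s × suc f ≡ 2 ℕ.^ s × 1# + P ≡ Y * Z ^ f →
               ∃[ q ] SmallBase q P × Y ^ a * (Z ^ b * P ^ c) ≡ (Y ^ suc q * (Z ^ q * P)) ^ (2 ℕ.^ k)
    conclude (s , 2j≡q , suc[f]≡q , 1+P≡) = 2 ℕ.^ s ,
      small-base noLarge irrP j s 2j≡q (subst (λ q → 1# + Y ^ suc q ≡ Z * P) 2j≡q 1+Yᵘ≡ZP) ,
      subst (λ q → Y ^ a * (Z ^ b * P ^ c) ≡ (Y ^ suc q * (Z ^ q * P)) ^ (2 ℕ.^ k)) 2j≡q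
        (one-sided-power irrP Y≢P Z≢P k l m f (j ℕ.+ j) (trans suc[f]≡q (sym 2j≡q)) 1+Yᵘ≡ZP 1+P≡ eq)

no-large-base′ : NoLargeBase X+1,X
no-large-base′ s {P} irrP eq = no-large-base s (irreducible-∘[X+1] irrP) (begin
  (X + 1#) * (P ∘ (X + 1#))                         ≡⟨ ∘-* (X + 1#) X P ⟨
  (X * P) ∘ (X + 1#)                                ≡⟨ cong (_∘ (X + 1#)) eq ⟩
  (1# + (X + 1#) ^ suc N) ∘ (X + 1#)                ≡⟨ ∘-+ (X + 1#) 1# ((X + 1#) ^ suc N) ⟩
  1# + ((X + 1#) ^ suc N) ∘ (X + 1#)                ≡⟨ cong (1# +_) (∘-^ (X + 1#) (X + 1#) (suc N)) ⟩
  1# + X ^ suc N                                    ∎)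
  where
  open ≡-Reasoning
  N = 2 ℕ.^ (3 ℕ.+ s)

-- The case where P divides both 1 + Y^a and 1 + Z^b

module _ {Y Z : 𝔽₂[x]} (pair : ComplementaryPair Y Z) (pair′ : ComplementaryPair Z Y) where

  open ComplementaryPair pair

  -- The exponents of Y and P give 3 N = M + c and c = N + M, hence M = N and c = 2 N.
  two-sided-power : ∀ {P} → Irreducible P → Y ≢ P → Z ≢ P →
    ∀ k l m → (let N = 2 ℕ.^ k; a = 3 ℕ.* N; b = 3 ℕ.* 2 ℕ.^ l; c = 2 ℕ.^ m) →
    1# + Y ^ 3 ≡ Z * P → 1# + Z ^ 3 ≡ Y * P → 1# + P ≡ Y * Z →
    (1# + Y ^ a) * ((1# + Z ^ b) * (1# + P ^ c)) ≡ Y ^ a * (Z ^ b * P ^ c) →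
    Y ^ a * (Z ^ b * P ^ c) ≡ (Y ^ 3 * (Z ^ 3 * P ^ 2)) ^ N
  two-sided-power {P} irrP Y≢P Z≢P k l m 1+Y³≡ 1+Z³≡ 1+P≡ eq = begin
    Y ^ a * (Z ^ b * P ^ c)
      ≡⟨ cong₂ (λ u v → Y ^ a * (Z ^ (3 ℕ.* u) * P ^ v)) M≡N c≡2N ⟩
    Y ^ a * (Z ^ a * P ^ (2 ℕ.* N))           ≡⟨ ^-^-distrib-*₃ Y Z P 3 3 2 N ⟨
    (Y ^ 3 * (Z ^ 3 * P ^ 2)) ^ N             ∎
    where
    open ≡-Reasoning
    N = 2 ℕ.^ k
    M = 2 ℕ.^ l
    a = 3 ℕ.* N
    b = 3 ℕ.* M
    c = 2 ℕ.^ m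
    exponents : a ≡ M ℕ.+ c × b ≡ N ℕ.+ c × c ≡ N ℕ.+ M
    exponents = exponents-unique irrY irrZ irrP Y≢Z Y≢P Z≢P a b c (M ℕ.+ c) (N ℕ.+ c) (N ℕ.+ M) (begin
      Y ^ a * (Z ^ b * P ^ c)
        ≡⟨ eq ⟨
      (1# + Y ^ a) * ((1# + Z ^ b) * (1# + P ^ c))
        ≡⟨ cong₂ _*_ (trans (1+^-* 3 k Y) (trans (cong (_^ N) 1+Y³≡) (^-distrib-* Z P N)))
             (cong₂ _*_ (trans (1+^-* 3 l Z) (trans (cong (_^ M) 1+Z³≡) (^-distrib-* Y P M)))
               (trans (sym (frobenius-1+ m P)) (trans (cong (_^ c) 1+P≡) (^-distrib-* Y Z c)))) ⟩
      (Z ^ N * P ^ N) * ((Y ^ M * P ^ M) * (Y ^ c * Z ^ c))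
        ≡⟨ solve 6 (λ zn pn ym pm yc zc → (zn :* pn) :* ((ym :* pm) :* (yc :* zc))
             := (ym :* yc) :* ((zn :* zc) :* (pn :* pm))) refl
             (Z ^ N) (P ^ N) (Y ^ M) (P ^ M) (Y ^ c) (Z ^ c) ⟩
      (Y ^ M * Y ^ c) * ((Z ^ N * Z ^ c) * (P ^ N * P ^ M))
        ≡⟨ cong₂ _*_ (^-homo-* Y M c) (cong₂ _*_ (^-homo-* Z N c) (^-homo-* P N M)) ⟨
      Y ^ (M ℕ.+ c) * (Z ^ (N ℕ.+ c) * P ^ (N ℕ.+ M)) ∎)
    M≡N : M ≡ N
    M≡N = sym (ℕ.*-cancelˡ-≡ N M 2 (ℕ.+-cancelˡ-≡ N _ _ (begin
      3 ℕ.* N                    ≡⟨ proj₁ exponents ⟩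
      M ℕ.+ c                    ≡⟨ cong (M ℕ.+_) (proj₂ (proj₂ exponents)) ⟩
      M ℕ.+ (N ℕ.+ M)            ≡⟨ ℕ.+-comm M (N ℕ.+ M) ⟩
      (N ℕ.+ M) ℕ.+ M            ≡⟨ ℕ.+-assoc N M M ⟩
      N ℕ.+ (M ℕ.+ M)            ≡⟨ cong (λ n → N ℕ.+ (M ℕ.+ n)) (ℕ.+-identityʳ M) ⟨
      N ℕ.+ 2 ℕ.* M              ∎)))
    c≡2N : c ≡ 2 ℕ.* N
    c≡2N = trans (proj₂ (proj₂ exponents))
      (trans (cong (N ℕ.+_) M≡N) (cong (N ℕ.+_) (sym (ℕ.+-identityʳ N))))

  -- The two shapes 1 + P = Y Z^f and 1 + P = Z Y^e are only compatible for e = f = 1.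
  two-sided-base : ∀ {P} → Irreducible P → Y ≢ P → Z ≢ P → ∀ j i e f → j ≢ 0 → i ≢ 0 →
    1# + Y ^ suc (j ℕ.+ j) ≡ Z * P → 1# + Z ^ suc (i ℕ.+ i) ≡ Y * P → 1# + P ≡ Y ^ e * Z ^ f →
    j ≡ 1 × i ≡ 1 × 1# + P ≡ Y * Z
  two-sided-base {P} irrP Y≢P Z≢P j i e f j≢0 i≢0 1+Yᵘ≡ 1+Zᵛ≡ 1+P≡ = conclude
    (base-shape pair irrP Y≢P Z≢P j e f j≢0 1+Yᵘ≡ 1+P≡)
    (base-shape pair′ irrP Z≢P Y≢P i f e i≢0 1+Zᵛ≡ (trans 1+P≡ (*-comm (Y ^ e) (Z ^ f))))
    where
    half : ∀ j → j ℕ.+ j ≡ 2 → j ≡ 1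
    half 1 _ = refl
    half (suc (suc j)) eq with () ← trans (sym (ℕ.+-suc j (suc j)))
      (ℕ.suc-injective (ℕ.suc-injective eq))
    conclude : ∃[ s ] j ℕ.+ j ≡ 2 ℕ.^ s × suc f ≡ 2 ℕ.^ s × 1# + P ≡ Y * Z ^ f →
               ∃[ t ] i ℕ.+ i ≡ 2 ℕ.^ t × suc e ≡ 2 ℕ.^ t × 1# + P ≡ Z * Y ^ e →
               j ≡ 1 × i ≡ 1 × 1# + P ≡ Y * Z
    conclude (s , 2j≡ , suc[f]≡ , 1+P≡YZᶠ) (t , 2i≡ , suc[e]≡ , 1+P≡ZYᵉ) =
      half j (trans 2j≡ (trans (sym suc[f]≡)
        (cong suc (^-injective irrZ f 1 (trans Zᶠ≡Z (*-comm 1# Z)))))) ,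
      half i (trans 2i≡ (trans (sym suc[e]≡) (cong suc (sym (proj₁ valuations))))) ,
      trans 1+P≡YZᶠ (cong (Y *_) Zᶠ≡Z)
      where
      valuations : 1 ≡ e × Z ^ f ≡ Z
      valuations = valuation-unique irrY 1 e {Z ^ f} {Z} (∤-^ irrY f Y∤Z) Y∤Z
        (trans (cong (_* Z ^ f) (*-comm Y 1#)) (trans (sym 1+P≡YZᶠ) (trans 1+P≡ZYᵉ (*-comm Z (Y ^ e)))))
      Zᶠ≡Z = proj₂ valuations

  two-sided : ∀ {P} → Irreducible P → Y ≢ P → Z ≢ P →
    ∀ k j l i m e f → j ≢ 0 → i ≢ 0 →
    (let a = suc (j ℕ.+ j) ℕ.* 2 ℕ.^ k; b = suc (i ℕ.+ i) ℕ.* 2 ℕ.^ l; c = 2 ℕ.^ m) →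
    1# + Y ^ suc (j ℕ.+ j) ≡ Z * P → 1# + Z ^ suc (i ℕ.+ i) ≡ Y * P → 1# + P ≡ Y ^ e * Z ^ f →
    (1# + Y ^ a) * ((1# + Z ^ b) * (1# + P ^ c)) ≡ Y ^ a * (Z ^ b * P ^ c) →
    1# + P ≡ Y * Z × Y ^ a * (Z ^ b * P ^ c) ≡ (Y ^ 3 * (Z ^ 3 * P ^ 2)) ^ (2 ℕ.^ k)
  two-sided {P} irrP Y≢P Z≢P k j l i m e f j≢0 i≢0 1+Yᵘ≡ 1+Zᵛ≡ 1+P≡ eq =
    conclude j i 1+Yᵘ≡ 1+Zᵛ≡ eq (two-sided-base irrP Y≢P Z≢P j i e f j≢0 i≢0 1+Yᵘ≡ 1+Zᵛ≡ 1+P≡)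
    where
    c = 2 ℕ.^ m
    conclude : ∀ j i → (let a = suc (j ℕ.+ j) ℕ.* 2 ℕ.^ k; b = suc (i ℕ.+ i) ℕ.* 2 ℕ.^ l) →
      1# + Y ^ suc (j ℕ.+ j) ≡ Z * P → 1# + Z ^ suc (i ℕ.+ i) ≡ Y * P →
      (1# + Y ^ a) * ((1# + Z ^ b) * (1# + P ^ c)) ≡ Y ^ a * (Z ^ b * P ^ c) →
      j ≡ 1 × i ≡ 1 × 1# + P ≡ Y * Z →
      1# + P ≡ Y * Z × Y ^ a * (Z ^ b * P ^ c) ≡ (Y ^ 3 * (Z ^ 3 * P ^ 2)) ^ (2 ℕ.^ k)
    conclude _ _ 1+Y³≡ 1+Z³≡ eq (refl , refl , 1+P≡YZ) =
      1+P≡YZ , two-sided-power irrP Y≢P Z≢P k l m 1+Y³≡ 1+Z³≡ 1+P≡YZ eq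

-- The condition σ*(A) = A for A = Y^a Z^b P^c with distinct primes and positive exponents.
Equation : 𝔽₂[x] → 𝔽₂[x] → 𝔽₂[x] → ℕ → ℕ → ℕ → Set
Equation Y Z P a b c = (1# + Y ^ a) * ((1# + Z ^ b) * (1# + P ^ c)) ≡ Y ^ a * (Z ^ b * P ^ c)

Equation-swap : ∀ {Y Z P} a b c → Equation Y Z P a b c → Equation Z Y P b a c
Equation-swap {Y} {Z} {P} a b c eq = trans (swap-factors (1# + Z ^ b) (1# + Y ^ a) (1# + P ^ c))
  (trans eq (swap-factors (Y ^ a) (Z ^ b) (P ^ c)))

module _ {Y Z : 𝔽₂[x]} (pair : ComplementaryPair Y Z) where

  open ComplementaryPair pair

  1+Y^≡ZP⇒≢0 : ∀ {P} → Irreducible P → ∀ j → 1# + Y ^ suc (j ℕ.+ j) ≡ Z * P → j ≢ 0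
  1+Y^≡ZP⇒≢0 {P} irrP _ eq refl = irreducible-≢1 irrP (*-cancelˡ (irreducible-≢0 irrZ) (begin
    Z * P           ≡⟨ eq ⟨
    1# + Y * 1#     ≡⟨ cong (1# +_) (*-comm Y 1#) ⟩
    1# + Y          ≡⟨ 1+Y≡Z ⟩
    Z               ≡⟨ *-comm 1# Z ⟩
    Z * 1#          ∎))
    where open ≡-Reasoning

  1+Y^∣ : ∀ {P} u k b c → Equation Y Z P (u ℕ.* 2 ℕ.^ k) b c →
          1# + Y ^ u ∣ Y ^ (u ℕ.* 2 ℕ.^ k) * (Z ^ b * P ^ c)
  1+Y^∣ u k b c eq = ∣-trans (1+p^∣1+p^* Y u (2 ℕ.^ k))
    (subst (1# + Y ^ (u ℕ.* 2 ℕ.^ k) ∣_) eq (∣-*ʳ ((1# + Z ^ b) * (1# + _ ^ c)) ∣-refl))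

  1+P^∣ : ∀ {P} w m a b → Equation Y Z P a b (w ℕ.* 2 ℕ.^ m) →
          1# + P ^ w ∣ Y ^ a * (Z ^ b * P ^ (w ℕ.* 2 ℕ.^ m))
  1+P^∣ {P} w m a b eq = ∣-trans (1+p^∣1+p^* P w (2 ℕ.^ m))
    (subst (1# + P ^ (w ℕ.* 2 ℕ.^ m) ∣_) eq (∣-*ˡ (1# + Y ^ a) (∣-*ˡ (1# + Z ^ b) ∣-refl)))

  -- If a and b are powers of 2, then P does not divide the left-hand side.
  not-both-2^ : ∀ {P} → Irreducible P → Y ≢ P → Z ≢ P → ∀ k l c → 0 < c →
    ¬ Equation Y Z P (2 ℕ.^ k) (2 ℕ.^ l) c
  not-both-2^ {P} irrP Y≢P Z≢P k l c@(suc c-1) 0<c eq =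
    ∤-* irrP (subst (P ∤_) (sym (1+Y^2^ pair k))
      (∤-^ irrP (2 ℕ.^ k) (distinct-irreducibles irrP irrZ (λ P≡Z → Z≢P (sym P≡Z)))))
      (∤-* irrP (subst (P ∤_) (sym (1+Z^2^ pair l))
        (∤-^ irrP (2 ℕ.^ l) (distinct-irreducibles irrP irrY (λ P≡Y → Y≢P (sym P≡Y)))))
        (∤1+^ irrP c 0<c))
      (subst (P ∣_) (sym eq) (∣-*ˡ (Y ^ (2 ℕ.^ k)) (∣-*ˡ (Z ^ (2 ℕ.^ l)) (∣-*ʳ (P ^ c-1) ∣-refl))))

-- From exponents to the listed polynomials

Classified : 𝔽₂[x] → Set
Classified A = ListedPower A ⊎ ListedPower (A ∘ (X + 1#))

classified-^ : ∀ {A} B n → Listed B → A ≡ B ^ (2 ℕ.^ n) → Classified A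
classified-^ B n listed A≡ = inj₁ (B , n , listed , A≡)

classified-∘-^ : ∀ {A} B n → Listed (B ∘ (X + 1#)) → A ≡ B ^ (2 ℕ.^ n) → Classified A
classified-∘-^ B n listed refl = inj₂ (B ∘ (X + 1#) , n , listed , ∘-^ (X + 1#) B (2 ℕ.^ n))

module _ {P : 𝔽₂[x]} (irrP : Irreducible P) (X≢P : X ≢ P) (X+1≢P : X + 1# ≢ P) where

  private
    Z = X + 1#

  Goal : ℕ → ℕ → ℕ → Set
  Goal a b c = Equation X Z P a b c → Classified (X ^ a * (Z ^ b * P ^ c))

  small-base-classified : ∀ {A} q k → SmallBase X,X+1 q P → A ≡ (X ^ suc q * (Z ^ q * P)) ^ (2 ℕ.^ k) →
    Classified A
  -- Once q and P are explicit, the base evaluates to the listed polynomial, whatever the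
  -- bracketing.
  small-base-classified _ k (inj₁ (refl , refl)) = classified-^ _ k case-ii₁
  small-base-classified _ k (inj₂ (refl , refl)) = classified-^ _ k case-ii₂

  small-base-classified′ : ∀ {A} q k → SmallBase X+1,X q P →
    A ≡ (Z ^ suc q * (X ^ q * P)) ^ (2 ℕ.^ k) → Classified A
  small-base-classified′ _ k (inj₁ (refl , refl)) = classified-∘-^
    (Z ^ 3 * (X ^ 2 * (Z ^ 2 + Z + 1#))) k case-ii₁
  small-base-classified′ _ k (inj₂ (refl , refl)) = classified-∘-^
    (Z ^ 5 * (X ^ 4 * (Z ^ 4 + Z ^ 3 + Z ^ 2 + Z + 1#))) k case-ii₂

  one-sided-classified : ∀ k j l m e f → 1# + X ^ suc (j ℕ.+ j) ≡ Z * P → 1# + P ≡ X ^ e * Z ^ f →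
    Goal (suc (j ℕ.+ j) ℕ.* 2 ℕ.^ k) (2 ℕ.^ l) (2 ℕ.^ m)
  one-sided-classified k j l m e f 1+Xᵘ≡ 1+P≡ eq =
    conclude (one-sided X,X+1 no-large-base irrP X≢P X+1≢P k j l m e f
      (1+Y^≡ZP⇒≢0 X,X+1 irrP j 1+Xᵘ≡) 1+Xᵘ≡ 1+P≡ eq)
    where
    conclude : ∀ {A} → ∃[ q ] SmallBase X,X+1 q P × A ≡ (X ^ suc q * (Z ^ q * P)) ^ (2 ℕ.^ k) →
      Classified A
    conclude (q , small , A≡) = small-base-classified q k small A≡

  one-sided-classified′ : ∀ k l i m e f → 1# + Z ^ suc (i ℕ.+ i) ≡ X * P → 1# + P ≡ X ^ e * Z ^ f →
    Goal (2 ℕ.^ k) (suc (i ℕ.+ i) ℕ.* 2 ℕ.^ l) (2 ℕ.^ m)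
  one-sided-classified′ k l i m e f 1+Zᵛ≡ 1+P≡ eq =
    conclude (one-sided X+1,X no-large-base′ irrP X+1≢P X≢P l i k m f e
      (1+Y^≡ZP⇒≢0 X+1,X irrP i 1+Zᵛ≡) 1+Zᵛ≡
      (trans 1+P≡ (*-comm (X ^ e) (Z ^ f)))
        (Equation-swap (2 ℕ.^ k) (suc (i ℕ.+ i) ℕ.* 2 ℕ.^ l) (2 ℕ.^ m) eq))
    where
    a = 2 ℕ.^ k
    b = suc (i ℕ.+ i) ℕ.* 2 ℕ.^ l
    c = 2 ℕ.^ m
    conclude : ∃[ q ] SmallBase X+1,X q P × Z ^ b * (X ^ a * P ^ c) ≡ (Z ^ suc q * (X ^ q * P)) ^
      (2 ℕ.^ l) →
               Classified (X ^ a * (Z ^ b * P ^ c))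
    conclude (q , small , A≡) = small-base-classified′ q l small
      (trans (swap-factors (X ^ a) (Z ^ b) (P ^ c)) A≡)

  two-sided-classified : ∀ k j l i m e f →
    1# + X ^ suc (j ℕ.+ j) ≡ Z * P → 1# + Z ^ suc (i ℕ.+ i) ≡ X * P → 1# + P ≡ X ^ e * Z ^ f →
    Goal (suc (j ℕ.+ j) ℕ.* 2 ℕ.^ k) (suc (i ℕ.+ i) ℕ.* 2 ℕ.^ l) (2 ℕ.^ m)
  two-sided-classified k j l i m e f 1+Xᵘ≡ 1+Zᵛ≡ 1+P≡ eq =
    conclude (two-sided X,X+1 X+1,X irrP X≢P X+1≢P k j l i m e f (1+Y^≡ZP⇒≢0 X,X+1 irrP j 1+Xᵘ≡)
      (1+Y^≡ZP⇒≢0 X+1,X irrP i 1+Zᵛ≡) 1+Xᵘ≡ 1+Zᵛ≡ 1+P≡ eq)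
    where
    conclude : ∀ {A} → 1# + P ≡ X * Z × A ≡ (X ^ 3 * (Z ^ 3 * P ^ 2)) ^ (2 ℕ.^ k) → Classified A
    conclude (1+P≡XZ , A≡) = classified-^ _ k case-iii
      (trans A≡ (cong (λ p → (X ^ 3 * (Z ^ 3 * p ^ 2)) ^ (2 ℕ.^ k)) (1+-injective {P} {x²+x+1} 1+P≡XZ)))

  -- The odd part of c is 1. Those of a and b are each either 1 or bring in P; both being 1 is
  -- impossible, and the remaining possibilities are the one-sided case, its mirror image and the
  -- two-sided case.
  exponents-classified : ∀ a b c → 0 < a → 0 < b → 0 < c → Goal a b c
  exponents-classified a b c 0<a 0<b 0<c = decompose (odd-part a 0<a) (odd-part b 0<b) (odd-part c 0<c)
    where
    cases : ∀ k j l i m →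
      j ≡ 0 ⊎ 1# + X ^ suc (j ℕ.+ j) ≡ Z * P → i ≡ 0 ⊎ 1# + Z ^ suc (i ℕ.+ i) ≡ X * P →
      ∃[ e ] ∃[ f ] 1# + P ≡ X ^ e * Z ^ f →
      Goal (suc (j ℕ.+ j) ℕ.* 2 ℕ.^ k) (suc (i ℕ.+ i) ℕ.* 2 ℕ.^ l) (2 ℕ.^ m)
    cases k j l i m (inj₁ refl) (inj₁ refl) _ =
      subst₂ (λ a b → Goal a b (2 ℕ.^ m)) (sym (ℕ.*-identityˡ (2 ℕ.^ k)))
        (sym (ℕ.*-identityˡ (2 ℕ.^ l)))
        λ eq → contradiction eq (not-both-2^ X,X+1 irrP X≢P X+1≢P k l (2 ℕ.^ m) (2^n>0 m))
    cases k j l i m (inj₂ 1+Xᵘ≡) (inj₁ refl) (e , f , 1+P≡) =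
      subst (λ b → Goal (suc (j ℕ.+ j) ℕ.* 2 ℕ.^ k) b (2 ℕ.^ m)) (sym (ℕ.*-identityˡ (2 ℕ.^ l)))
        (one-sided-classified k j l m e f 1+Xᵘ≡ 1+P≡)
    cases k j l i m (inj₁ refl) (inj₂ 1+Zᵛ≡) (e , f , 1+P≡) =
      subst (λ a → Goal a (suc (i ℕ.+ i) ℕ.* 2 ℕ.^ l) (2 ℕ.^ m)) (sym (ℕ.*-identityˡ (2 ℕ.^ k)))
        (one-sided-classified′ k l i m e f 1+Zᵛ≡ 1+P≡)
    cases k j l i m (inj₂ 1+Xᵘ≡) (inj₂ 1+Zᵛ≡) (e , f , 1+P≡) = two-sided-classified k j l i m e f 1+Xᵘ≡
      1+Zᵛ≡ 1+P≡
    decompose : ∀ {a b c} → ∃[ k ] ∃[ j ] a ≡ suc (j ℕ.+ j) ℕ.* 2 ℕ.^ k →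
      ∃[ l ] ∃[ i ] b ≡ suc (i ℕ.+ i) ℕ.* 2 ℕ.^ l →
                ∃[ m ] ∃[ h ] c ≡ suc (h ℕ.+ h) ℕ.* 2 ℕ.^ m → Goal a b c
    decompose {a} {b} {c} (k , j , a≡) (l , i , b≡) (m , h , c≡) eq = go
      (1+P^odd∣ X,X+1 irrP X≢P X+1≢P h a b c
        (subst (λ c → 1# + P ^ w ∣ X ^ a * (Z ^ b * P ^ c)) (sym c≡)
        (1+P^∣ X,X+1 w m a b (subst (Equation X Z P a b) c≡ eq))))
      where
      u = suc (j ℕ.+ j)
      v = suc (i ℕ.+ i)
      w = suc (h ℕ.+ h)
      x-part : j ≡ 0 ⊎ 1# + X ^ u ≡ Z * P
      x-part = odd∣Y^*Z^*P^ X,X+1 irrP X≢P X+1≢P j a b c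
        (subst (λ a → 1# + X ^ u ∣ X ^ a * (Z ^ b * P ^ c)) (sym a≡)
        (1+Y^∣ X,X+1 u k b c (subst (λ a → Equation X Z P a b c) a≡ eq)))
      z-part : i ≡ 0 ⊎ 1# + Z ^ v ≡ X * P
      z-part = odd∣Y^*Z^*P^ X+1,X irrP X+1≢P X≢P i b a c
        (subst (λ b → 1# + Z ^ v ∣ Z ^ b * (X ^ a * P ^ c)) (sym b≡)
        (1+Y^∣ X+1,X v l a c (subst (λ b → Equation Z X P b a c) b≡ (Equation-swap a b c eq))))
      go : h ≡ 0 × (∃[ e ] ∃[ f ] 1# + P ≡ X ^ e * Z ^ f) → Classified (X ^ a * (Z ^ b * P ^ c))
      go (refl , 1+P≡) = subst₂ (λ a b → Goal a b c) (sym a≡) (sym b≡)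
        (subst (Goal (u ℕ.* 2 ℕ.^ k) (v ℕ.* 2 ℕ.^ l)) (sym (trans c≡ (ℕ.*-identityˡ (2 ℕ.^ m))))
          (cases k j l i m x-part z-part 1+P≡)) eq

-- Reduction to at most three prime factors

four-factors : ∀ {A P Q} → A ≢ 0# → Irreducible P → Irreducible Q →
  X ∣ A → X + 1# ∣ A → P ∣ A → Q ∣ A → X ≢ P → X ≢ Q → X + 1# ≢ P → X + 1# ≢ Q → P ≢ Q → 4 ≤ ω A
four-factors {A} {P} {Q} A≢0 irrP irrQ X∣A X+1∣A P∣A Q∣A X≢P X≢Q X+1≢P X+1≢Q P≢Q =
  unique-⊆⇒length≤ {xs = X ∷ X + 1# ∷ P ∷ Q ∷ []}
    (((λ ()) All.∷ X≢P All.∷ X≢Q All.∷ All.[]) ∷ (X+1≢P All.∷ X+1≢Q All.∷ All.[]) ∷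
      (P≢Q All.∷ All.[]) ∷ All.[] ∷ [])
    λ { (here refl)                         → factor irreducible-X X∣A
      ; (there (here refl))                 → factor irreducible-X+1 X+1∣A
      ; (there (there (here refl)))         → factor irrP P∣A
      ; (there (there (there (here refl)))) → factor irrQ Q∣A }
  where
  factor : ∀ {p} → Irreducible p → p ∣ A → p ∈ monicIrreducibleFactors A
  factor {p} irr p∣A = Equivalence.from (∈-monicIrreducibleFactors A≢0)
    (≢0⇒monic {p} (irreducible-≢0 irr) , irr , p∣A)

∣∧∤⇒≢ : ∀ {p q f} → p ∤ f → q ∣ f → p ≢ q
∣∧∤⇒≢ p∤f q∣f refl = p∤f q∣f

-- The exact powers of X and X + 1 are split off first. If the cofactor is 1, two primes remain;
-- otherwise the power of a further prime P is split off as well.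
unitaryPerfect⇒classified : ∀ A → 0 < deg A → ω A ≤ 3 → UnitaryPerfect A → Classified A
unitaryPerfect⇒classified A 0<A ω≤3 perfect = split-X
  (extract-power irreducible-X (deg A) A ℕ.≤-refl A≢0)
  where
  Z = X + 1#
  X∣A : X ∣ A
  X∣A = unitaryPerfect⇒∣ X,X+1 A 0<A perfect
  Z∣A : Z ∣ A
  Z∣A = unitaryPerfect⇒∣ X+1,X A 0<A perfect
  A≢0 : A ≢ 0#
  A≢0 refl = contradiction 0<A λ ()

  split-P : ∀ a b {P} → 0 < a → 0 < b → Irreducible P → X ≢ P → Z ≢ P → P ∣ A →
            ∀ c K → 0 < c → P ∤ K → A ≡ X ^ a * (Z ^ b * (P ^ c * K)) → X ∤ K → Z ∤ K → Classified A
  split-P a b _ _ _ _ _ _ c 0# _ P∤K _ _ _ = contradiction (0# , refl) P∤K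
  split-P a b {P} 0<a 0<b irrP X≢P Z≢P _ c (nz one) 0<c _ A≡ _ _ =
    subst Classified (sym A≡′) (exponents-classified irrP X≢P Z≢P a b c 0<a 0<b 0<c
      (trans (sym (σ*-three irreducible-X irreducible-X+1 irrP (λ ()) X≢P Z≢P a b c 0<a 0<b 0<c))
        (subst UnitaryPerfect A≡′ perfect)))
    where
    A≡′ : A ≡ X ^ a * (Z ^ b * P ^ c)
    A≡′ = trans A≡ (cong (λ p → X ^ a * (Z ^ b * p)) (*-comm (P ^ c) 1#))
  -- A nonconstant cofactor K has a prime divisor other than X, X + 1 and P, which would be a fourth
  -- prime factor of A.
  split-P a b {P} _ _ irrP X≢P Z≢P P∣A c K@(nz (_ ∷ _)) _ P∤K A≡ X∤K Z∤K = fourth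
    (irreducible-divisor (deg K) K ℕ.≤-refl (s≤s z≤n))
    where
    fourth : ∃[ Q ] Irreducible Q × Q ∣ K → Classified A
    fourth (Q , irrQ , Q∣K) = contradiction (ℕ.≤-trans (four-factors A≢0 irrP irrQ X∣A Z∣A P∣A
      (subst (Q ∣_) (sym A≡) (∣-*ˡ (X ^ a) (∣-*ˡ (Z ^ b) (∣-*ˡ (P ^ c) Q∣K))))
      X≢P (∣∧∤⇒≢ X∤K Q∣K) Z≢P (∣∧∤⇒≢ Z∤K Q∣K) (∣∧∤⇒≢ P∤K Q∣K)) ω≤3) (ℕ.<-irrefl refl)

  split-N : ∀ a b N → 0 < a → 0 < b → A ≡ X ^ a * (Z ^ b * N) → X ∤ N → Z ∤ N → Classified A
  split-N a b 0# _ _ _ X∤N _ = contradiction (0# , refl) X∤N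
  split-N a b (nz one) 0<a 0<b A≡ _ _ = subst Classified (sym A≡′) (conclude
    (two-factors X,X+1 a b 0<a 0<b
      (trans (sym (σ*-two irreducible-X irreducible-X+1 (λ ()) a b 0<a 0<b))
      (subst UnitaryPerfect A≡′ perfect))))
    where
    A≡′ : A ≡ X ^ a * Z ^ b
    A≡′ = trans A≡ (cong (X ^ a *_) (*-comm (Z ^ b) 1#))
    conclude : ∀ {A} → ∃[ s ] A ≡ (X * Z) ^ (2 ℕ.^ s) → Classified A
    conclude (s , A≡) = classified-^ _ s case-i A≡
  split-N a b N@(nz (_ ∷ _)) 0<a 0<b A≡ X∤N Z∤N = third
    (irreducible-divisor (deg N) N ℕ.≤-refl (s≤s z≤n))
    where
    third : ∃[ P ] Irreducible P × P ∣ N → Classified A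
    third (P , irrP , P∣N) = with-power (extract-power irrP (deg N) N ℕ.≤-refl (λ ()))
      where
      with-power : ∃[ c ] ∃[ K ] N ≡ P ^ c * K × P ∤ K → Classified A
      with-power (zero , K , N≡K , P∤K) = contradiction (subst (P ∣_) N≡K P∣N) P∤K
      with-power (suc c , K , N≡ , P∤K) = split-P a b 0<a 0<b irrP (∣∧∤⇒≢ X∤N P∣N) (∣∧∤⇒≢ Z∤N P∣N)
        (subst (P ∣_) (sym A≡) (∣-*ˡ (X ^ a) (∣-*ˡ (Z ^ b) P∣N))) (suc c) K (s≤s z≤n) P∤K
        (trans A≡ (cong (λ N → X ^ a * (Z ^ b * N)) N≡))
        (λ X∣K → X∤N (subst (X ∣_) (sym N≡) (∣-*ˡ (P ^ suc c) X∣K)))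
        (λ Z∣K → Z∤N (subst (Z ∣_) (sym N≡) (∣-*ˡ (P ^ suc c) Z∣K)))

  split-Z : ∀ a M → 0 < a → A ≡ X ^ a * M → X ∤ M → ∃[ b ] ∃[ N ] M ≡ Z ^ b * N × Z ∤ N → Classified A
  split-Z a M 0<a A≡ X∤M (zero , N , refl , Z∤N) = contradiction (subst (Z ∣_) A≡ Z∣A)
    (∤-* irreducible-X+1 (∤-^ irreducible-X+1 a (ComplementaryPair.Z∤Y X,X+1)) Z∤N)
  split-Z a M 0<a A≡ X∤M (suc b , N , refl , Z∤N) =
    split-N a (suc b) N 0<a (s≤s z≤n) A≡ (λ X∣N → X∤M (∣-*ˡ (Z ^ suc b) X∣N)) Z∤N

  split-X : ∃[ a ] ∃[ M ] A ≡ X ^ a * M × X ∤ M → Classified A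
  split-X (zero , M , A≡ , X∤M) = contradiction (subst (X ∣_) A≡ X∣A) X∤M
  split-X (suc a , M , A≡ , X∤M) = split-Z (suc a) M (s≤s z≤n) A≡ X∤M
    (extract-power irreducible-X+1 (deg M) M ℕ.≤-refl λ { refl → X∤M (0# , refl) })

theorem3p1 : (A : 𝔽₂[x]) → 0 < deg A → ω A ≤ 3 →
  UnitaryPerfect A ⇔ (ListedPower A ⊎ ListedPower (A ∘ (X + 1#)))
theorem3p1 A 0<A ω≤3 = mk⇔ (unitaryPerfect⇒classified A 0<A ω≤3) (listedPower⇒unitaryPerfect A)
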